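{- A Sturmian word $w$ over $\{a,b\}$ is not quasiperiodic if and only if it can be infinitely decomposed over $\{L_a, R_b\}$ or over $\{L_b, R_a\}$. In other words, a Sturmian word $w$ is not quasiperiodic if and only if there are integers $(d_k)_{k\ge 1}$ with $d_1 \geq 0$ and $d_k \geq 1$ for all $k \geq 2$ such that $$w = \lim_{n\rightarrow\infty} L_a^{d_1}R_b^{d_2} L_a^{d_3} R_b^{d_4}\cdots L_a^{d_{2n-1}} R_b^{d_{2n}}(a)$$ or $$w = \lim_{n\rightarrow\infty} L_b^{d_1}R_a^{d_2} L_b^{d_3} R_a^{d_4}\cdots L_b^{d_{2n-1}} R_a^{d_{2n}}(a).$$
   Context: Words are over the alphabet $\{a,b\}$; $|u|_a$ is the number of occurrences of $a$ in $u$. A word is balanced if $||u|_a-|v|_a|\le 1$ for any two of its factors $u,v$ of the same length. An infinite (i.e. right-infinite) word is ultimately periodic if it equals $uv^\omega$ for finite words $u$ and $v\neq\varepsilon$. A Sturmian word is an infinite balanced word over $\{a,b\}$ that is not ultimately periodic. An infinite word $w$ is quasiperiodic if there exist a finite word $u$ (a quasiperiod of $w$) and finite words $(p_n)_{n\ge 0}$ with $p_0=\varepsilon$ such that, for all $n\ge 0$, $0<|p_{n+1}|-|p_n|\le |u|$ and $p_nu$ is a prefix of $w$. The morphisms on $\{a,b\}^*$ (extended letterwise to infinite words) are: $L_a: a\mapsto a,\ b\mapsto ab$; $L_b: a\mapsto ba,\ b\mapsto b$; $R_a: a\mapsto a,\ b\mapsto ba$; $R_b: a\mapsto ab,\ b\mapsto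 b$. Juxtaposition denotes composition: $f_1f_2\cdots f_n(a)=f_1(f_2(\cdots f_n(a)\cdots))$. An infinite word $w$ can be infinitely decomposed over a set $X$ of morphisms if $w=\lim_{n\to\infty} f_1f_2\cdots f_n(a)$ for some sequence $(f_i)_{i\ge1}$ of elements of $X$. Here $\lim_{n} w_n = w$ (finite words $w_n$, infinite word $w$) means that for each $k$, for all large enough $n$, $w_n$ has length at least $k$ and has the same prefix of length $k$ as $w$. -}

module Defs where

open import Data.List using (List; []; _∷_; [_]; _++_; length; filter; take; lookup; concatMap; applyUpTo; foldr)
open import Data.List.NonEmpty using (List⁺; _∷_)
open import Data.Nat using (ℕ; zero; suc; _+_; _*_; _∸_; _≤_; _<_; ∣_-_∣)
open import Data.Nat.DivMod using (_mod_)
open import Data.Product using (_×_; ∃-syntax; Σ-syntax)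
open import Function using (_∘_; id)
open import Level using (0ℓ)
open import Relation.Binary.Definitions using (DecidableEquality)
open import Relation.Binary.PropositionalEquality using (_≡_; _≗_; refl)
open import Relation.Nullary using (¬_; yes; no)
open import Relation.Unary using (Pred)

data Letter : Set where
  a b : Letter

_≟_ : DecidableEquality Letter
a ≟ a = yes refl
a ≟ b = no λ ()
b ≟ a = no λ ()
b ≟ b = yes refl

Word : Set
Word = List Letter

-- w n is the letter at position n, counted from 0; equality of infinite words
-- is pointwise.
InfWord : Set
InfWord = ℕ → Letter

∣_∣ₐ : Word → ℕ
∣ u ∣ₐ = length (filter (_≟ a) u)

prefixOfLength : ℕ → InfWord → Word
prefixOfLength k w = applyUpTo w k

_IsPrefixOf_ : Word → InfWord → Set
u IsPrefixOf w = u ≡ prefixOfLength (length u) w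

_IsFactorOf_ : Word → InfWord → Set
u IsFactorOf w = ∃[ p ] (p ++ u) IsPrefixOf w

Balanced : InfWord → Set
Balanced w = ∀ u v → u IsFactorOf w → v IsFactorOf w →
  length u ≡ length v → ∣ ∣ u ∣ₐ - ∣ v ∣ₐ ∣ ≤ 1

infixr 5 _++ω_

_++ω_ : Word → InfWord → InfWord
([] ++ω w) n = w n
((x ∷ u) ++ω w) zero = x
((x ∷ u) ++ω w) (suc n) = (u ++ω w) n

_^ω : List⁺ Letter → InfWord
((x ∷ v) ^ω) n = lookup (x ∷ v) (n mod length (x ∷ v))

UltimatelyPeriodic : InfWord → Set
UltimatelyPeriodic w = ∃[ u ] ∃[ v ] w ≗ u ++ω (v ^ω)

Sturmian : InfWord → Set
Sturmian w = Balanced w × ¬ UltimatelyPeriodic w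

-- Truncated subtraction is harmless: the strict lower bound forces
-- length (p n) < length (p (suc n)).
IsQuasiperiodOf : Word → InfWord → Set
IsQuasiperiodOf u w = Σ[ p ∈ (ℕ → Word) ]
  p 0 ≡ [] ×
  (∀ n → 0 < length (p (suc n)) ∸ length (p n)
       × length (p (suc n)) ∸ length (p n) ≤ length u
       × (p n ++ u) IsPrefixOf w)

Quasiperiodic : InfWord → Set
Quasiperiodic w = ∃[ u ] IsQuasiperiodOf u w

-- An endomorphism of the free monoid on {a, b}, given by the images of the
-- letters.
Morphism : Set
Morphism = Letter → Word

apply : Morphism → Word → Word
apply = concatMap

La Lb Ra Rb : Morphism

La a = a ∷ []
La b = a ∷ b ∷ []

Lb a = b ∷ a ∷ []
Lb b = b ∷ []

Ra a = a ∷ []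
Ra b = b ∷ a ∷ []

Rb a = a ∷ b ∷ []
Rb b = b ∷ []

open import Function.Endo.Propositional Word public using (Endo; _^_)

-- F 0 ∘ F 1 ∘ … ∘ F (n ∸ 1); the sequence f₁, f₂, … is indexed from 0.
composite : (ℕ → Endo) → ℕ → Endo
composite F n = foldr (λ f g → f ∘ g) id (applyUpTo F n)

IsLimitOf : InfWord → (ℕ → Word) → Set
IsLimitOf w u = ∀ k → ∃[ N ] (∀ n → N ≤ n →
  k ≤ length (u n) × take k (u n) ≡ prefixOfLength k w)

InfinitelyDecomposableOver : Pred Morphism 0ℓ → InfWord → Set
InfinitelyDecomposableOver X w = ∃[ f ]
  (∀ i → X (f i)) × IsLimitOf w (λ n → composite (apply ∘ f) n [ a ])

-- f^(d₁) g^(d₂) f^(d₃) g^(d₄) ⋯ f^(d₂ₙ₋₁) g^(d₂ₙ) (a), where d k stands for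
-- the exponent with index k + 1.
alternating : Morphism → Morphism → (ℕ → ℕ) → ℕ → Word
alternating f g d n =
  composite (λ i → (apply f ^ d (2 * i)) ∘ (apply g ^ d (2 * i + 1))) n [ a ]

{-# OPTIONS --safe #-}

-- Fix a letter x and let y be the other one; the relevant morphisms are
-- L_x : x ↦ x, y ↦ xy and R_y : x ↦ xy, y ↦ y. Both map a single letter, or an
-- unbordered word that begins with x and ends with y, to a word of one of these
-- two kinds. An aperiodic word decomposed over {L_x, R_y} thus has arbitrarily long
-- unbordered prefixes, which excludes quasiperiods. Conversely, let w be a
-- Sturmian word that begins with x and is not quasiperiodic. If yy occurs in w,
-- then xx does not, and w = R_y(w′). Otherwise y is isolated and w = L_x(w′);
-- here w′ begins with x, since a word beginning with xy in which y is isolated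
-- is covered by x y x^m, m being the length of the shortest run of x after a y.
-- In both cases w′ is again Sturmian, not quasiperiodic and begins with x, so the
-- desubstitution never stops, and aperiodicity makes both morphisms occur
-- infinitely often.
module Submission where

open import Defs
open import Axiom.ExcludedMiddle using (ExcludedMiddle)
open import Data.Fin using (Fin; zero; suc; toℕ)
open import Data.Fin.Properties using (toℕ-fromℕ<)
open import Data.List using ([]; _∷_; [_]; _++_; length; filter; take; lookup; replicate)
open import Data.List.NonEmpty using (_∷_)
open import Data.List.Properties using (length-++; ++-assoc; ++-identityʳ; filter-++; concatMap-++;
    ∷-injectiveˡ; ∷-injectiveʳ; length-replicate; ++-cancelˡ; ++-identityˡ-unique; ++-conicalʳ; length-++-≤ˡ)
open import Data.Nat using (ℕ; zero; suc; _+_; _*_; _∸_; _≤_; _<_; z≤n; s≤s; s≤s⁻¹; ∣_-_∣; _≤?_)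
open import Data.Nat.DivMod using (_mod_; _%_; _/_; m%n<n; m≡m%n+[m/n]*n)
open import Data.Nat.Properties hiding (_≟_)
open import Data.Product using (_×_; _,_; proj₁; proj₂; ∃-syntax; Σ-syntax)
open import Data.Sum using (_⊎_; inj₁; inj₂)
open import Data.Unit using (⊤; tt)
open import Function using (_∘_; id; _⇔_; mk⇔)
open import Level using (0ℓ)
open import Relation.Binary.PropositionalEquality using (_≡_; _≢_; refl; sym; trans; cong; cong₂; subst;
    subst₂; module ≡-Reasoning)
open import Relation.Nullary using (Dec; ¬_; yes; no; contradiction)
open import Relation.Unary using (｛_｝; _∪_)

-- Occurrences of finite words in infinite words

Occurs : InfWord → ℕ → Word → Set
Occurs w i []      = ⊤
Occurs w i (z ∷ u) = w i ≡ z × Occurs w (suc i) u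

segment : InfWord → ℕ → ℕ → Word
segment w i zero    = []
segment w i (suc n) = w i ∷ segment w (suc i) n

length-segment : ∀ w i n → length (segment w i n) ≡ n
length-segment w i zero    = refl
length-segment w i (suc n) = cong suc (length-segment w (suc i) n)

segment-occurs : ∀ w i n → Occurs w i (segment w i n)
segment-occurs w i zero    = tt
segment-occurs w i (suc n) = refl , segment-occurs w (suc i) n

segment-+ : ∀ w i m n → segment w i (m + n) ≡ segment w i m ++ segment w (i + m) n
segment-+ w i zero    n = cong (λ k → segment w k n) (sym (+-identityʳ i))
segment-+ w i (suc m) n = cong (w i ∷_) (trans (segment-+ w (suc i) m n)
  (cong (λ k → segment w (suc i) m ++ segment w k n) (sym (+-suc i m))))

segment-tail : ∀ w i n → segment w (suc i) n ≡ segment (w ∘ suc) i n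
segment-tail w i zero    = refl
segment-tail w i (suc n) = cong (w (suc i) ∷_) (segment-tail w (suc i) n)

segment-prefix : ∀ w n → segment w 0 n ≡ prefixOfLength n w
segment-prefix w zero    = refl
segment-prefix w (suc n) =
  cong (w 0 ∷_) (trans (segment-tail w 0 n) (segment-prefix (w ∘ suc) n))

occurs⇒segment : ∀ w i u → Occurs w i u → u ≡ segment w i (length u)
occurs⇒segment w i []      _        = refl
occurs⇒segment w i (z ∷ u) (eq , o) = cong₂ _∷_ (sym eq) (occurs⇒segment w (suc i) u o)

prefix⇒occurs : ∀ {w u} → u IsPrefixOf w → Occurs w 0 u
prefix⇒occurs {w} {u} eq =
  subst (Occurs w 0) (trans (segment-prefix w (length u)) (sym eq)) (segment-occurs w 0 (length u))

occurs⇒prefix : ∀ {w u} → Occurs w 0 u → u IsPrefixOf w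
occurs⇒prefix {w} {u} o = trans (occurs⇒segment w 0 u o) (segment-prefix w (length u))

occurs-++⁺ : ∀ {w i} u {v} → Occurs w i u → Occurs w (i + length u) v → Occurs w i (u ++ v)
occurs-++⁺ {w} {i} []      {v} _        o′ = subst (λ k → Occurs w k v) (+-identityʳ i) o′
occurs-++⁺ {w} {i} (z ∷ u) {v} (eq , o) o′ =
  eq , occurs-++⁺ u o (subst (λ k → Occurs w k v) (+-suc i (length u)) o′)

occurs-++⁻ˡ : ∀ {w i} u {v} → Occurs w i (u ++ v) → Occurs w i u
occurs-++⁻ˡ []      _        = tt
occurs-++⁻ˡ (z ∷ u) (eq , o) = eq , occurs-++⁻ˡ u o

occurs-++⁻ʳ : ∀ {w i} u {v} → Occurs w i (u ++ v) → Occurs w (i + length u) v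
occurs-++⁻ʳ {w} {i} []      {v} o        = subst (λ k → Occurs w k v) (sym (+-identityʳ i)) o
occurs-++⁻ʳ {w} {i} (z ∷ u) {v} (eq , o) =
  subst (λ k → Occurs w k v) (sym (+-suc i (length u))) (occurs-++⁻ʳ u o)

occurs-agree : ∀ {w w′ i j k} u → Occurs w i u → Occurs w′ j u → k < length u → w (i + k) ≡ w′ (j + k)
occurs-agree {w} {w′} {i} {j} {zero} (z ∷ u) (eq , _) (eq′ , _) _ =
  trans (cong w (+-identityʳ i)) (trans (trans eq (sym eq′)) (cong w′ (sym (+-identityʳ j))))
occurs-agree {w} {w′} {i} {j} {suc k} (z ∷ u) (_ , o) (_ , o′) (s≤s k<n) =
  trans (cong w (+-suc i k)) (trans (occurs-agree u o o′ k<n) (cong w′ (sym (+-suc j k))))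

agree-occurs : ∀ {w w′ i j} u → Occurs w i u → (∀ k → k < length u → w (i + k) ≡ w′ (j + k)) → Occurs w′ j u
agree-occurs                 []      _        _ = tt
agree-occurs {w} {w′} {i} {j} (z ∷ u) (eq , o) h =
  trans (cong w′ (sym (+-identityʳ j))) (trans (sym (h 0 (s≤s z≤n))) (trans (cong w (+-identityʳ i)) eq)) ,
  agree-occurs u o λ k k<n →
    trans (cong w (sym (+-suc i k))) (trans (h (suc k) (s≤s k<n)) (cong w′ (+-suc j k)))

occurs-extends : ∀ {w i} u v → Occurs w i u → Occurs w i v → length u ≤ length v → ∃[ r ] v ≡ u ++ r
occurs-extends []      v       _        _         _       = v , refl
occurs-extends (z ∷ u) (c ∷ v) (eq , o) (eq′ , o′) (s≤s l) with occurs-extends u v o o′ l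
... | r , refl = r , cong (_∷ u ++ r) (trans (sym eq′) eq)

occurs-replicate : ∀ {w i z} m → Occurs w i (replicate m z) → w (i + m) ≡ z →
  Occurs w i (replicate (suc m) z)
occurs-replicate {w} {i} zero    _        e = trans (cong w (sym (+-identityʳ i))) e , tt
occurs-replicate {w} {i} (suc m) (eq , o) e = eq , occurs-replicate m o (trans (cong w (sym (+-suc i m))) e)

replicate-lookup : ∀ {w i z k} m → Occurs w i (replicate m z) → k < m → w (i + k) ≡ z
replicate-lookup {w} {i} {k = zero}  (suc m) (eq , _) _         = trans (cong w (+-identityʳ i)) eq
replicate-lookup {w} {i} {k = suc k} (suc m) (_ , o)  (s≤s k<m) =
  trans (cong w (+-suc i k)) (replicate-lookup m o k<m)

++-split : ∀ (u : Word) {k} → k ≤ length u → ∃[ u₁ ] ∃[ u₂ ] u ≡ u₁ ++ u₂ × length u₁ ≡ k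
++-split u       {zero}  _       = [] , u , refl , refl
++-split (z ∷ u) {suc k} (s≤s l) with ++-split u l
... | u₁ , u₂ , refl , refl = z ∷ u₁ , u₂ , refl , refl

take-++ˡ : ∀ k (u v : Word) → k ≤ length u → take k (u ++ v) ≡ take k u
take-++ˡ zero    u       v _       = refl
take-++ˡ (suc k) (z ∷ u) v (s≤s l) = cong (z ∷_) (take-++ˡ k u v l)

occurs-take : ∀ {w i} k u → Occurs w i u → k ≤ length u → take k u ≡ segment w i k
occurs-take zero    u       _        _       = refl
occurs-take (suc k) (z ∷ u) (eq , o) (s≤s l) = cong₂ _∷_ (sym eq) (occurs-take k u o l)

-- The slack `j` lets a caller ask a limit for more letters than `u` has, which rules out words that
-- are too short.
take⇒occurs : ∀ {w} u v {j} → take (length u + j) (u ++ v) ≡ prefixOfLength (length u + j) w → Occurs w 0 u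
take⇒occurs []      v eq = tt
take⇒occurs (z ∷ u) v eq = sym (∷-injectiveˡ eq) , shift u (take⇒occurs u v (∷-injectiveʳ eq))
  where
  shift : ∀ {w i} u → Occurs (w ∘ suc) i u → Occurs w (suc i) u
  shift []      _        = tt
  shift (z ∷ u) (eq , o) = eq , shift u o

-- Eventual periodicity

EventuallyPeriodic : InfWord → Set
EventuallyPeriodic w = ∃[ i ] ∃[ j ] i < j × (∀ k → w (i + k) ≡ w (j + k))

eventuallyPeriodic⇒ultimatelyPeriodic : ∀ {w} → EventuallyPeriodic w → UltimatelyPeriodic w
eventuallyPeriodic⇒ultimatelyPeriodic {w} (i , j , i<j , shift) =
  segment w 0 i , (w i ∷ tail) , λ n → glue 0 i n λ k → sym (repeat k)
  where
  -- One less than the period `q`, which is j - i, so that the repeated word `w i ∷ tail` is visibly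
  -- nonempty.
  p = j ∸ suc i
  tail = segment w (suc i) p
  q = suc p

  i+q≡j : i + q ≡ j
  i+q≡j = trans (+-suc i p) (m+[n∸m]≡n i<j)

  period : ∀ k → w (i + (q + k)) ≡ w (i + k)
  period k = sym (trans (shift k) (cong w (trans (cong (_+ k) (sym i+q≡j)) (+-assoc i q k))))

  periods : ∀ c r → w (i + (r + c * q)) ≡ w (i + r)
  periods zero    r = cong (λ t → w (i + t)) (+-identityʳ r)
  periods (suc c) r = trans (cong (λ t → w (i + t)) rearrange) (trans (period (r + c * q)) (periods c r))
    where
    rearrange : r + (q + c * q) ≡ q + (r + c * q)
    rearrange = trans (sym (+-assoc r q (c * q))) (trans (cong (_+ c * q) (+-comm r q)) (+-assoc q r (c * q)))

  lookup-segment : ∀ i m (k : Fin (length (segment w i m))) → lookup (segment w i m) k ≡ w (i + toℕ k)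
  lookup-segment i (suc m) zero    = cong w (sym (+-identityʳ i))
  lookup-segment i (suc m) (suc k) = trans (lookup-segment (suc i) m k) (cong w (sym (+-suc i (toℕ k))))

  repeat : ∀ n → ((w i ∷ tail) ^ω) n ≡ w (i + n)
  repeat n = begin
    lookup (w i ∷ tail) (n mod suc (length tail))  ≡⟨ lookup-segment i q (n mod suc (length tail)) ⟩
    w (i + toℕ (n mod suc (length tail)))          ≡⟨ cong (λ t → w (i + t))
        (toℕ-fromℕ< (m%n<n n (suc (length tail)))) ⟩
    w (i + n % suc (length tail))                  ≡⟨ cong (λ t → w (i + n % suc t))
        (length-segment w (suc i) p) ⟩
    w (i + n % q)                                  ≡⟨ sym (periods (n / q) (n % q)) ⟩
    w (i + (n % q + (n / q) * q))                  ≡⟨ cong (λ t → w (i + t)) (sym (m≡m%n+[m/n]*n n q)) ⟩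
    w (i + n)                                      ∎
    where open ≡-Reasoning

  glue : ∀ s m n {t} → (∀ k → w (s + m + k) ≡ t k) → w (s + n) ≡ (segment w s m ++ω t) n
  glue s zero    n       h = trans (cong (λ r → w (r + n)) (sym (+-identityʳ s))) (h n)
  glue s (suc m) zero    h = cong w (+-identityʳ s)
  glue s (suc m) (suc n) h =
    trans (cong w (+-suc s n)) (glue (suc s) m n λ k → trans (cong (λ r → w (r + k)) (sym (+-suc s m))) (h k))

-- Letter counts and balance

other : Letter → Letter
other a = b
other b = a

other≢ : ∀ x → other x ≢ x
other≢ a ()
other≢ b ()

data View (x : Letter) : Letter → Set where
  same : View x x
  diff : View x (other x)

view : ∀ x z → View x z
view a a = same
view a b = diff
view b a = diff
view b b = same

same⊎other : ∀ x z → z ≡ x ⊎ z ≡ other x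
same⊎other x z with view x z
... | same = inj₁ refl
... | diff = inj₂ refl

≢⇒other : ∀ {x z} → z ≢ x → z ≡ other x
≢⇒other {x} {z} z≢x with view x z
... | same = contradiction refl z≢x
... | diff = refl

count : Letter → Word → ℕ
count z u = length (filter (_≟ z) u)

count-++ : ∀ z u v → count z (u ++ v) ≡ count z u + count z v
count-++ z u v = trans (cong length (filter-++ (_≟ z) u v)) (length-++ (filter (_≟ z) u))

count-same : ∀ z u → count z (z ∷ u) ≡ suc (count z u)
count-same a u = refl
count-same b u = refl

count-diff : ∀ {z c} u → c ≢ z → count z (c ∷ u) ≡ count z u
count-diff {z} {c} u c≢z with c ≟ z
... | yes c≡z = contradiction c≡z c≢z
... | no _    = refl

count-++-≤ : ∀ z u v → count z u ≤ count z (u ++ v)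
count-++-≤ z u v = subst (count z u ≤_) (sym (count-++ z u v)) (m≤m+n _ _)

count-complement : ∀ z u → count z u + count (other z) u ≡ length u
count-complement z [] = refl
count-complement z (c ∷ u) with view z c
... | same = trans (cong₂ _+_ (count-same z u) (count-diff u (other≢ z ∘ sym)))
    (cong suc (count-complement z u))
... | diff = trans (cong₂ _+_ (count-diff u (other≢ z)) (count-same (other z) u))
               (trans (+-suc _ _) (cong suc (count-complement z u)))

count-replicate-diff : ∀ {z c} m → c ≢ z → count z (replicate m c) ≡ 0
count-replicate-diff zero    _   = refl
count-replicate-diff {z} {c} (suc m) c≢z = trans (count-diff (replicate m c) c≢z) (count-replicate-diff m c≢z)

count-prefix : ∀ z k u → k ≤ count z u → ∃[ u₁ ] ∃[ u₂ ] u ≡ u₁ ++ u₂ × count z u₁ ≡ k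
count-prefix z zero    u       _ = [] , u , refl , refl
count-prefix z (suc k) (c ∷ u) l with c ≟ z
... | yes refl with count-prefix z k u (s≤s⁻¹ l)
...   | u₁ , u₂ , refl , eq = z ∷ u₁ , u₂ , refl , trans (count-same z u₁) (cong suc eq)
count-prefix z (suc k) (c ∷ u) l | no c≢z with count-prefix z (suc k) u l
...   | u₁ , u₂ , refl , eq = c ∷ u₁ , u₂ , refl , trans (count-diff u₁ c≢z) eq

-- Allowing |u| ≤ |v| instead of |u| = |v| is equivalent, and absorbs the length
-- changes caused by a morphism.
BalancedFor : Letter → InfWord → Set
BalancedFor z w = ∀ {i j} u v → Occurs w i u → Occurs w j v → length u ≤ length v →
  count z u ≤ suc (count z v)

-- Cutting `v` down to the length of `u` can only lower its count, so words of equal length suffice.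
balancedFor : ∀ {z w} →
  (∀ {i j} u v → Occurs w i u → Occurs w j v → length u ≡ length v → count z u ≤ suc (count z v)) →
  BalancedFor z w
balancedFor {z} h u v o o′ l with ++-split v l
... | v₁ , v₂ , refl , eq =
  ≤-trans (h u v₁ o (occurs-++⁻ˡ v₁ o′) (sym eq)) (s≤s (count-++-≤ z v₁ v₂))

balanced⇒balancedFor-a : ∀ {w} → Balanced w → BalancedFor a w
balanced⇒balancedFor-a {w} bal = balancedFor λ u v o o′ eq →
  ≤-trans (m≤n+∣m-n∣ (count a u) (count a v))
    (subst (count a v + ∣ count a u - count a v ∣ ≤_) (+-comm (count a v) 1)
      (+-monoʳ-≤ (count a v) (bal u v (factor u o) (factor v o′) eq)))
  where
  factor : ∀ {i} u → Occurs w i u → u IsFactorOf w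
  factor {i} u o = segment w 0 i , occurs⇒prefix (occurs-++⁺ (segment w 0 i) (segment-occurs w 0 i)
    (subst (λ k → Occurs w k u) (sym (length-segment w 0 i)) o))

-- At equal lengths the two letter counts are complementary: an excess of one letter in `u` is an
-- excess of the other in `v`. Hence the hypothesis is used with `u` and `v` exchanged.
balancedFor-other : ∀ {z w} → BalancedFor z w → BalancedFor (other z) w
balancedFor-other {z} bal = balancedFor λ u v o o′ eq →
  +-cancelˡ-≤ (count z u) _ _ (≤-trans (≤-reflexive
      (trans (count-complement z u) (trans eq (sym (count-complement z v)))))
    (≤-trans (+-monoˡ-≤ (count (other z) v) (bal v u o′ o (≤-reflexive (sym eq))))
      (≤-reflexive (sym (+-suc _ _)))))

balanced-all : ∀ {w} z → BalancedFor z w → ∀ c → BalancedFor c w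
balanced-all z bal c with view z c
... | same = bal
... | diff = balancedFor-other bal

-- Images of infinite words

-- This stands for w = F(w′), expressed through prefixes so that `F` never has to be extended to
-- infinite words.
Image : Endo → InfWord → InfWord → Set
Image F w′ w = ∀ u → Occurs w′ 0 u → Occurs w 0 (F u)

apply-++ : ∀ f u v → apply f (u ++ v) ≡ apply f u ++ apply f v
apply-++ = concatMap-++

apply-[] : ∀ f z → apply f [ z ] ≡ f z
apply-[] f z = ++-identityʳ (f z)

Nonerasing : Morphism → Set
Nonerasing f = ∀ z → 1 ≤ length (f z)

length-apply : ∀ f → Nonerasing f → ∀ u → length u ≤ length (apply f u)
length-apply f ne []      = z≤n
length-apply f ne (z ∷ u) =
  subst (suc (length u) ≤_) (sym (length-++ (f z))) (+-mono-≤ (ne z) (length-apply f ne u))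

position : Morphism → InfWord → ℕ → ℕ
position f w i = length (apply f (segment w 0 i))

module _ (f : Morphism) {w′ w : InfWord} (image : Image (apply f) w′ w) where

  image-occurs : ∀ i u → Occurs w′ i u → Occurs w (position f w′ i) (apply f u)
  image-occurs i u o = occurs-++⁻ʳ (apply f s) (subst (Occurs w 0) (apply-++ f s u) (image (s ++ u)
    (occurs-++⁺ s (segment-occurs w′ 0 i) (subst (λ k → Occurs w′ k u) (sym (length-segment w′ 0 i)) o))))
    where s = segment w′ 0 i

  image-eventuallyPeriodic : Nonerasing f → EventuallyPeriodic w′ → EventuallyPeriodic w
  image-eventuallyPeriodic ne (i , j , i<j , shift) = position f w′ i , position f w′ j , pos< , agree
    where
    p = j ∸ i

    pos< : position f w′ i < position f w′ j
    pos< = begin-strict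
      position f w′ i                                                    <⟨ m<m+n _ positive ⟩
      position f w′ i + length (apply f (segment w′ i p))                ≡⟨ sym
          (length-++ (apply f (segment w′ 0 i))) ⟩
      length (apply f (segment w′ 0 i) ++ apply f (segment w′ i p))      ≡⟨ cong length
          (sym (apply-++ f (segment w′ 0 i) (segment w′ i p))) ⟩
      length (apply f (segment w′ 0 i ++ segment w′ i p))                ≡⟨ cong (length ∘ apply f)
          (sym (segment-+ w′ 0 i p)) ⟩
      position f w′ (i + p)                                              ≡⟨ cong (position f w′)
          (m+[n∸m]≡n (<⇒≤ i<j)) ⟩
      position f w′ j                                                    ∎
      where
      open ≤-Reasoning
      positive : 0 < length (apply f (segment w′ i p))
      positive = ≤-trans (m<n⇒0<n∸m i<j) (≤-trans (≤-reflexive (sym (length-segment w′ i p)))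
        (length-apply f ne (segment w′ i p)))

    agree : ∀ k → w (position f w′ i + k) ≡ w (position f w′ j + k)
    -- As `f` erases nothing, the image of `suc k` letters has more than `k` letters, so equal
    -- segments of `w′` decide the letter at offset `k`.
    agree k = occurs-agree (apply f u) (image-occurs i u (segment-occurs w′ i (suc k)))
      (image-occurs j u (agree-occurs u (segment-occurs w′ i (suc k)) λ r _ → shift r))
      (≤-trans (≤-reflexive (sym (length-segment w′ i (suc k)))) (length-apply f ne u))
      where u = segment w′ i (suc k)

  -- The images of `u` and of all `p n` work. With p (n+1) = p₀ r, the word `r` is a nonempty prefix
  -- of `u`, because consecutive occurrences of `u` overlap or touch. The new gap is the length of
  -- the image of `r`, which is positive and at most that of the image of `u`.
  image-quasiperiodic : Nonerasing f → Quasiperiodic w′ → Quasiperiodic w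
  image-quasiperiodic ne (u , p , p0≡[] , h) =
    apply f u , apply f ∘ p , cong (apply f) p0≡[] , covers
    where
    covers : ∀ n → 0 < length (apply f (p (suc n))) ∸ length (apply f (p n))
                 × length (apply f (p (suc n))) ∸ length (apply f (p n)) ≤ length (apply f u)
                 × (apply f (p n) ++ apply f u) IsPrefixOf w
    covers n with h n
    ... | pos , short , pre
      with p n | p (suc n) | prefix⇒occurs pre | occurs-++⁻ˡ (p (suc n))
          (prefix⇒occurs (proj₂ (proj₂ (h (suc n)))))
    ... | p₀ | p₁ | o₀ | o₁ with occurs-extends p₀ p₁ (occurs-++⁻ˡ p₀ o₀) o₁
        (<⇒≤ (m∸n≢0⇒n<m λ eq → <⇒≢ pos (sym eq)))
    ... | r , refl with occurs-extends (p₀ ++ r) (p₀ ++ u) o₁ o₀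
                         (subst (length (p₀ ++ r) ≤_) (sym (length-++ p₀))
                             (≤-trans (m≤n+m∸n _ (length p₀)) (+-monoʳ-≤ (length p₀) short)))
    ... | t , eq = subst (0 <_) (sym gap) r>0
                 , subst (_≤ length (apply f u)) (sym gap) r≤u
                 , occurs⇒prefix (subst (Occurs w 0) (apply-++ f p₀ u) (image (p₀ ++ u) o₀))
      where
      u≡r++t : u ≡ r ++ t
      u≡r++t = ++-cancelˡ p₀ _ _ (trans eq (++-assoc p₀ r t))

      gap : length (apply f (p₀ ++ r)) ∸ length (apply f p₀) ≡ length (apply f r)
      gap = trans (cong (_∸ length (apply f p₀)) (trans (cong length (apply-++ f p₀ r))
          (length-++ (apply f p₀))))
              (m+n∸m≡n (length (apply f p₀)) _)

      r>0 : 0 < length (apply f r)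
      r>0 = ≤-trans (subst (0 <_) (trans (cong (_∸ length p₀) (length-++ p₀)) (m+n∸m≡n (length p₀) _)) pos)
              (length-apply f ne r)

      r≤u : length (apply f r) ≤ length (apply f u)
      r≤u = ≤-trans (m≤m+n _ (length (apply f t)))
        (≤-reflexive (sym (trans (cong (length ∘ apply f) u≡r++t) (trans (cong length (apply-++ f r t))
            (length-++ (apply f r))))))

-- Reads `w` block by block from the left. `Inv` is what has to hold at a block boundary for a next
-- block to exist: nothing for R_y, and the letter x for L_x.
decode : ∀ f w (Inv : ℕ → Set) → Inv 0 →
  (∀ i → Inv i → ∃[ z ] Occurs w i (f z) × Inv (i + length (f z))) →
  ∃[ w′ ] Image (apply f) w′ w
decode f w Inv inv₀ next = letter , occurs 0
  where
  state : ℕ → Σ[ i ∈ ℕ ] Inv i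
  state zero    = 0 , inv₀
  state (suc n) = _ , proj₂ (proj₂ (next (proj₁ (state n)) (proj₂ (state n))))

  letter : InfWord
  letter n = proj₁ (next (proj₁ (state n)) (proj₂ (state n)))

  occurs : ∀ n u → Occurs letter n u → Occurs w (proj₁ (state n)) (apply f u)
  occurs n []      _          = tt
  occurs n (z ∷ u) (refl , o) =
    occurs-++⁺ (f z) (proj₁ (proj₂ (next (proj₁ (state n)) (proj₂ (state n))))) (occurs (suc n) u o)

-- The morphisms x ↦ x, y ↦ xy (left) and x ↦ xy, y ↦ y (right), where y = other x,
-- so that mor a ranges over L_a, R_b and mor b over L_b, R_a.
data Side : Set where
  left right : Side

mor : Letter → Side → Morphism
mor a left  = La
mor a right = Rb
mor b left  = Lb
mor b right = Ra

left-same : ∀ x → mor x left x ≡ x ∷ []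
left-same a = refl
left-same b = refl

left-diff : ∀ x → mor x left (other x) ≡ x ∷ other x ∷ []
left-diff a = refl
left-diff b = refl

right-same : ∀ x → mor x right x ≡ x ∷ other x ∷ []
right-same a = refl
right-same b = refl

right-diff : ∀ x → mor x right (other x) ≡ other x ∷ []
right-diff a = refl
right-diff b = refl

nonerasing : ∀ x s → Nonerasing (mor x s)
nonerasing a left  a = s≤s z≤n
nonerasing a left  b = s≤s z≤n
nonerasing a right a = s≤s z≤n
nonerasing a right b = s≤s z≤n
nonerasing b left  a = s≤s z≤n
nonerasing b left  b = s≤s z≤n
nonerasing b right a = s≤s z≤n
nonerasing b right b = s≤s z≤n

-- The letter whose image is xy. Either morphism preserves the number of its occurrences and
-- lengthens a word by exactly that number.
doubled : Letter → Side → Letter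
doubled x left  = other x
doubled x right = x

count-mor : ∀ x s z → count (doubled x s) (mor x s z) ≡ count (doubled x s) [ z ]
                    × length (mor x s z) ≡ suc (count (doubled x s) [ z ])
count-mor a left  a = refl , refl
count-mor a left  b = refl , refl
count-mor a right a = refl , refl
count-mor a right b = refl , refl
count-mor b left  a = refl , refl
count-mor b left  b = refl , refl
count-mor b right a = refl , refl
count-mor b right b = refl , refl

count-apply : ∀ x s u → count (doubled x s) (apply (mor x s) u) ≡ count (doubled x s) u
count-apply x s []      = refl
count-apply x s (z ∷ u) = trans (count-++ c (mor x s z) _)
  (trans (cong₂ _+_ (proj₁ (count-mor x s z)) (count-apply x s u)) (sym (count-++ c [ z ] u)))
  where c = doubled x s

length-apply-mor : ∀ x s u → length (apply (mor x s) u) ≡ length u + count (doubled x s) u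
length-apply-mor x s []      = refl
length-apply-mor x s (z ∷ u) = begin
  length (mor x s z ++ apply (mor x s) u)         ≡⟨ length-++ (mor x s z) ⟩
  length (mor x s z) + length (apply (mor x s) u) ≡⟨ cong₂ _+_ (proj₂ (count-mor x s z))
      (length-apply-mor x s u) ⟩
  suc (count c [ z ] + (length u + count c u))    ≡⟨ cong suc (sym (+-assoc (count c [ z ]) (length u) _)) ⟩
  suc (count c [ z ] + length u + count c u)      ≡⟨ cong (λ k → suc (k + count c u))
      (+-comm (count c [ z ]) (length u)) ⟩
  suc (length u + count c [ z ] + count c u)      ≡⟨ cong suc (+-assoc (length u) _ _) ⟩
  suc (length u + (count c [ z ] + count c u))    ≡⟨ cong (λ k → suc (length u + k))
      (sym (count-++ c [ z ] u)) ⟩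
  suc (length u + count c (z ∷ u))                ∎
  where
  c = doubled x s
  open ≡-Reasoning

left-head : ∀ x z → ∃[ t ] mor x left z ≡ x ∷ t
left-head x z with view x z
... | same = [] , left-same x
... | diff = [ other x ] , left-diff x

right-last : ∀ x z → ∃[ t ] mor x right z ≡ t ++ [ other x ]
right-last x z with view x z
... | same = [ x ] , right-same x
... | diff = [] , right-diff x

-- Balance passes to the preimage

module _ {x : Letter} {w′ w : InfWord} (image : Image (apply (mor x left)) w′ w) where

  -- Every block of L_x begins with x. An unbalanced pair is transferred to `w` by deleting the
  -- first x of the image of `u` and appending to the image of `v` the x that begins the next block.
  -- The y-counts still differ by two, while the lengths are again in the right order.
  left-balanced : BalancedFor (other x) w → BalancedFor (other x) w′
  left-balanced bal {i} {j} u v o o′ l = ≮⇒≥ contra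
    where
    y = other x
    f = mor x left

    contra : ¬ (suc (count y v) < count y u)
    -- Cutting `u` where the excess is exactly two makes the length of its image comparable with
    -- that of `v`.
    contra lt with count-prefix y (2 + count y v) u lt
    ... | c ∷ u₁ , u₂ , refl , eq with left-head x c | image-occurs f image i (c ∷ u₁)
        (occurs-++⁻ˡ (c ∷ u₁) o) | length-apply-mor x left (c ∷ u₁) | count-apply x left (c ∷ u₁)
    ...   | t , ft≡ | of | lf | cf rewrite ft≡ =
        1+n≰n (≤-trans (≤-reflexive (sym count-U)) (≤-trans (bal U V (proj₂ of) oV lUV)
            (s≤s (≤-reflexive count-V))))
      where
      U = t ++ apply f u₁
      V = apply f v ++ [ x ]

      count-U : count y U ≡ 2 + count y v
      count-U = trans (sym (count-diff U (other≢ x ∘ sym))) (trans cf eq)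

      count-V : count y V ≡ count y v
      count-V = trans (count-++ y (apply f v) [ x ])
          (trans (cong₂ _+_ (count-apply x left v) (count-diff [] (other≢ x ∘ sym))) (+-identityʳ _))

      oV : Occurs w (position f w′ j) V
      oV with left-head x (w′ (j + length v))
      ... | t′ , ft′≡ = occurs-++⁻ˡ V {t′} (subst (Occurs w _)
          (trans (apply-++ f v _) (trans (cong (apply f v ++_) (trans (apply-[] f _) ft′≡))
              (sym (++-assoc (apply f v) [ x ] t′))))
             (image-occurs f image j (v ++ [ w′ (j + length v) ]) (occurs-++⁺ v o′ (refl , tt))))

      lUV : length U ≤ length V
      lUV = begin
        length U                              ≡⟨ suc-injective lf ⟩
        length u₁ + count y (c ∷ u₁)          ≡⟨ cong (length u₁ +_) eq ⟩
        length u₁ + (2 + count y v)           ≡⟨ +-suc (length u₁) _ ⟩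
        suc (length u₁) + (1 + count y v)     ≤⟨ +-monoˡ-≤ (1 + count y v)
            (≤-trans (s≤s (≤-trans (m≤m+n (length u₁) (length u₂)) (≤-reflexive (sym (length-++ u₁))))) l) ⟩
        length v + (1 + count y v)            ≡⟨ +-suc (length v) _ ⟩
        suc (length v + count y v)            ≡⟨ cong suc (sym (length-apply-mor x left v)) ⟩
        suc (length (apply f v))              ≡⟨ +-comm 1 _ ⟩
        length (apply f v) + 1                ≡⟨ sym (length-++ (apply f v)) ⟩
        length V                              ∎
        where open ≤-Reasoning

module _ {x : Letter} {w′ w : InfWord} (image : Image (apply (mor x right)) w′ w) where

  right-head : w 0 ≡ x → w′ 0 ≡ x
  right-head w0≡x with same⊎other x (w′ 0)
  ... | inj₁ eq = eq
  ... | inj₂ eq with subst (Occurs w 0) (trans (apply-[] (mor x right) (other x)) (right-diff x))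
      (image [ other x ] (eq , tt))
  ...   | w0≡y , _ = contradiction (trans (sym w0≡y) w0≡x) (other≢ x)

  -- The mirror image of the argument for L_x: blocks of R_y end with y, so the last y of the image
  -- of `u` is deleted and a y is put in front of the image of `v`.
  right-balanced : w′ 0 ≡ x → BalancedFor x w → BalancedFor x w′
  right-balanced w′0≡x bal u v o o′ l = ≮⇒≥ (unbalanced u v o o′ l)
    where
    f = mor x right

    -- The letter y = other x preceding the image of v comes from the block before it.
    interior : ∀ {i j} u v → Occurs w′ i u → Occurs w′ (suc j) v → length u ≤ length v →
      count x u ≢ 2 + count x v
    interior {i} {j} u v o o′ l eq with right-last x (w′ j)
    ... | t′ , ft′≡ with lastBlock u refl
      where
      lastBlock : ∀ u′ → u ≡ u′ → u ≡ [] ⊎ ∃[ t ] apply f u ≡ t ++ [ other x ]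
      lastBlock []       u≡ = inj₁ u≡
      lastBlock (c ∷ u′) u≡ = inj₂ (subst (λ r → ∃[ t ] apply f r ≡ t ++ [ other x ]) (sym u≡) (ends c u′))
        where
        ends : ∀ c u → ∃[ t ] apply f (c ∷ u) ≡ t ++ [ other x ]
        ends c []       with right-last x c
        ... | t , ft≡ = t , trans (apply-[] f c) ft≡
        ends c (d ∷ u) with ends d u
        ... | t , ft≡ = f c ++ t , trans (cong (f c ++_) ft≡) (sym (++-assoc (f c) t [ other x ]))
    ... | inj₁ refl = 0≢1+n eq
    ... | inj₂ (t , ft≡) = 1+n≰n (≤-trans (≤-reflexive (sym count-t))
        (≤-trans (bal t V oT oV ltV) (s≤s (≤-reflexive count-V))))
      where
      y = other x
      V = y ∷ apply f v

      count-t : count x t ≡ 2 + count x v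
      count-t = begin
        count x t                   ≡⟨ sym (+-identityʳ _) ⟩
        count x t + 0               ≡⟨ cong (count x t +_) (sym (count-diff [] (other≢ x))) ⟩
        count x t + count x [ y ]   ≡⟨ sym (count-++ x t [ y ]) ⟩
        count x (t ++ [ y ])        ≡⟨ cong (count x) (sym ft≡) ⟩
        count x (apply f u)         ≡⟨ count-apply x right u ⟩
        count x u                   ≡⟨ eq ⟩
        2 + count x v               ∎
        where open ≡-Reasoning

      count-V : count x V ≡ count x v
      count-V = trans (count-diff (apply f v) (other≢ x)) (count-apply x right v)

      oT : Occurs w (position f w′ i) t
      oT = occurs-++⁻ˡ t (subst (Occurs w _) ft≡ (image-occurs f image i u o))

      oV : Occurs w (position f w′ j + length t′) V
      oV = occurs-++⁻ʳ t′ (subst (Occurs w _) (trans (cong (_++ apply f v) ft′≡) (++-assoc t′ [ y ] _))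
             (image-occurs f image j (w′ j ∷ v) (refl , o′)))

      ltV : length t ≤ length V
      ltV = s≤s⁻¹ (begin
        suc (length t)                   ≡⟨ +-comm 1 _ ⟩
        length t + 1                     ≡⟨ sym (length-++ t) ⟩
        length (t ++ [ y ])              ≡⟨ cong length (sym ft≡) ⟩
        length (apply f u)               ≡⟨ length-apply-mor x right u ⟩
        length u + count x u             ≤⟨ +-mono-≤ l (≤-reflexive eq) ⟩
        length v + (2 + count x v)       ≡⟨ trans (+-suc (length v) _) (cong suc (+-suc (length v) _)) ⟩
        2 + (length v + count x v)       ≡⟨ cong (2 +_) (sym (length-apply-mor x right v)) ⟩
        suc (length V)                   ∎)
        where open ≤-Reasoning

    unbalanced : ∀ {i j} u v → Occurs w′ i u → Occurs w′ j v → length u ≤ length v →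
      ¬ (suc (count x v) < count x u)
    unbalanced {j = suc j} u v o o′ l lt with count-prefix x (2 + count x v) u lt
    ... | u₁ , u₂ , refl , eq =
      interior u₁ v (occurs-++⁻ˡ u₁ o) o′ (≤-trans (subst (length u₁ ≤_) (sym (length-++ u₁))
          (m≤m+n _ _)) l) eq
    unbalanced {j = zero} []       []       _ _ _ ()
    -- At position 0 no block precedes, but there the second word begins with x. Without this x it
    -- starts at position 1 and has one x less. So `u` can be cut before its end and still have two
    -- more, and the lengths remain comparable.
    unbalanced {j = zero} u (c ∷ v) o (w′0≡c , o′) l lt with trans (sym w′0≡c) w′0≡x
    ... | refl with count-prefix x (2 + count x v) u
        (≤-trans (≤-reflexive (cong suc (sym (count-same x v)))) (≤-trans (n≤1+n _) lt))
    ...   | u₁ , [] , refl , eq =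
      1+n≰n (≤-trans (subst (λ k → suc (suc k) ≤ _) (count-same x v) lt)
          (≤-reflexive (trans (cong (count x) (++-identityʳ u₁)) eq)))
    ...   | u₁ , d ∷ u₂ , refl , eq =
      interior u₁ v (occurs-++⁻ˡ u₁ o) o′
        (s≤s⁻¹ (≤-trans (≤-trans (m<m+n (length u₁) (s≤s z≤n)) (≤-reflexive (sym (length-++ u₁)))) l)) eq

-- Desubstitution of Sturmian words that are not quasiperiodic

record Admissible (x : Letter) (w : InfWord) : Set where
  field
    start     : w 0 ≡ x
    balanced  : ∀ z → BalancedFor z w
    aperiodic : ¬ EventuallyPeriodic w
    ¬quasi    : ¬ Quasiperiodic w

open Admissible public

-- `Q` marks positions at which `u` occurs. Starting from 0, jumps of length at most that of `u`
-- give a covering, with the prefixes of `w` that end at the visited positions as `p`.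
chain⇒quasiperiodic : ∀ {w} u (Q : ℕ → Set) → Q 0 → (∀ i → Q i → Occurs w i u) →
  (∀ i → Q i → ∃[ j ] i < j × j ≤ i + length u × Q j) → Quasiperiodic w
chain⇒quasiperiodic {w} u Q q₀ occ next = u , (λ n → segment w 0 (pos n)) , refl , λ n →
  subst₂ (λ k l → 0 < k ∸ l × k ∸ l ≤ length u × (segment w 0 (pos n) ++ u) IsPrefixOf w)
    (sym (length-segment w 0 (pos (suc n)))) (sym (length-segment w 0 (pos n)))
    (let (_ , i<j , j≤ , _) = next (pos n) (proj₂ (state n)) in
      m<n⇒0<n∸m i<j , m≤n+o⇒m∸n≤o _ (pos n) j≤ ,
      occurs⇒prefix (occurs-++⁺ (segment w 0 (pos n)) (segment-occurs w 0 (pos n))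
        (subst (λ k → Occurs w k u) (sym (length-segment w 0 (pos n))) (occ (pos n) (proj₂ (state n))))))
  where
  state : ℕ → Σ[ i ∈ ℕ ] Q i
  state zero    = 0 , q₀
  state (suc n) = let (j , _ , _ , q) = next (proj₁ (state n)) (proj₂ (state n)) in j , q

  pos : ℕ → ℕ
  pos = proj₁ ∘ state

¬∀⇒∃¬ : ExcludedMiddle 0ℓ → {A : Set} {P : A → Set} → ¬ (∀ n → P n) → ∃[ n ] ¬ P n
¬∀⇒∃¬ em {P = P} ¬∀ with em {∃[ n ] ¬ P n}
... | yes ∃¬ = ∃¬
... | no ¬∃¬ = contradiction (λ n → pick n em) ¬∀
  where
  pick : ∀ n → Dec (P n) → P n
  pick n (yes p) = p
  pick n (no ¬p) = contradiction (n , ¬p) ¬∃¬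

last-true : ExcludedMiddle 0ℓ → {P : ℕ → Set} → P 0 → ¬ (∀ n → P n) → ∃[ n ] P n × ¬ P (suc n)
last-true em {P} p₀ ¬∀ with ¬∀⇒∃¬ em ¬∀
... | n , ¬pn = search n ¬pn
  where
  search : ∀ n → ¬ P n → ∃[ n ] P n × ¬ P (suc n)
  search zero    ¬p = contradiction p₀ ¬p
  search (suc n) ¬p with em {P n}
  ... | yes p = n , p , ¬p
  ... | no ¬q = search n ¬q

-- If w starts with xy and y is isolated, the runs of x between two letters y
-- have length m or m + 1 for some m ≥ 1, and w is covered by x y x^m.
isolated-xy⇒quasiperiodic : ExcludedMiddle 0ℓ → ∀ {x w} → (∀ z → BalancedFor z w) →
  ¬ EventuallyPeriodic w → (∀ i → w i ≡ other x → w (suc i) ≡ x) → w 0 ≡ x → w 1 ≡ other x →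
  Quasiperiodic w
isolated-xy⇒quasiperiodic em {x} {w} bal aper iso w0≡x w1≡y
  with last-true em {λ m → ∀ i → w i ≡ other x → Occurs w (suc i) (replicate m x)} (λ _ _ → tt)
         -- If every power of x followed the y at position 1, then `w` would be constant from
         -- position 2 on.
         (λ all → aper (2 , 3 , ≤-refl , λ k →
           trans (replicate-lookup (suc k) (all (suc k) 1 w1≡y) ≤-refl)
                 (sym (trans (cong w (sym (+-suc 2 k))) (replicate-lookup (suc (suc k))
                     (all (suc (suc k)) 1 w1≡y) ≤-refl)))))
... | zero , _ , ¬run = contradiction (λ i wi≡y → iso i wi≡y , tt) ¬run
... | suc k , run , ¬run with ¬∀⇒∃¬ em ¬run
...   | i₀ , ¬run₀ with ¬∀⇒∃¬ em ¬run₀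
...     | wi₀≡y , ¬run₁ =
  chain⇒quasiperiodic (x ∷ y ∷ replicate m x) Q (w0≡x , w1≡y)
    (λ { i (wi≡x , wsi≡y) → wi≡x , wsi≡y , run (suc i) wsi≡y }) next
  where
  y = other x
  m = suc k

  Q : ℕ → Set
  Q i = w i ≡ x × w (suc i) ≡ y

  shortRun : w (suc i₀ + m) ≡ y
  shortRun = ≢⇒other λ e → ¬run₁ (occurs-replicate m (run i₀ wi₀≡y) e)

  noLongRun : ∀ {i} → ¬ Occurs w i (replicate (2 + m) x)
  noLongRun o = 1+n≰n (≤-trans (≤-trans (≤-reflexive (sym count-short))
      (bal y short (replicate (2 + m) x) occ o len))
                  (≤-reflexive (cong suc (count-replicate-diff (2 + m) (other≢ x ∘ sym)))))
    where
    -- The factor y x^m y has two letters y, whereas x^(m+2) has the same length and none; balance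
    -- forbids the latter.
    short = y ∷ replicate m x ++ [ y ]

    occ : Occurs w i₀ short
    occ = wi₀≡y , occurs-++⁺ (replicate m x) (run i₀ wi₀≡y)
            (trans (cong (λ l → w (suc i₀ + l)) (length-replicate m)) shortRun , tt)

    len : length short ≤ length (replicate (2 + m) x)
    len = ≤-reflexive (cong suc (trans (length-++ (replicate m x)) (+-comm _ 1)))

    count-short : count y short ≡ 2
    count-short = trans (count-same y _) (cong suc (trans (count-++ y (replicate m x) [ y ])
      (cong₂ _+_ (count-replicate-diff m (other≢ x ∘ sym)) (count-same y []))))

  bound : ∀ i → i + length (x ∷ y ∷ replicate m x) ≡ 2 + (i + m)
  bound i = trans (cong (λ l → i + (2 + l)) (length-replicate m)) (trans (+-suc i _) (cong suc (+-suc i m)))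

  next : ∀ i → Q i → ∃[ j ] i < j × j ≤ i + length (x ∷ y ∷ replicate m x) × Q j
  -- The run of x after the y has length m or m + 1. In the first case the next xy starts at the
  -- last letter of the occurrence of x y x^m at `i`, in the second immediately after it.
  next i (_ , wsi≡y) with same⊎other x (w (2 + i + m))
  ... | inj₂ e = suc (i + m) , s≤s (m≤m+n i m) , ≤-trans (n≤1+n _) (≤-reflexive (sym (bound i))) , prev , e
    where
    prev : w (suc (i + m)) ≡ x
    prev = trans (cong (w ∘ suc) (+-suc i k)) (replicate-lookup m (run (suc i) wsi≡y) ≤-refl)
  ... | inj₁ e = 2 + (i + m) , s≤s (≤-trans (n≤1+n i) (s≤s (m≤m+n i m))) , ≤-reflexive (sym (bound i)) , e ,
      ≢⇒other λ e′ → noLongRun (occurs-replicate (suc m) (occurs-replicate m (run (suc i) wsi≡y) e)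
        (trans (cong (λ l → w (2 + l)) (+-suc i m)) e′))

-- Periods and quasiperiods are carried forward by images, so their absence is inherited by `w′`.
-- Balance is checked for the doubled letter only and then follows for the other.
step : ExcludedMiddle 0ℓ → ∀ {x w} → Admissible x w →
  ∃[ s ] ∃[ w′ ] Image (apply (mor x s)) w′ w × Admissible x w′
step em {x} {w} adm with em {∃[ i ] w i ≡ other x × w (suc i) ≡ other x}
... | yes (i , wi≡y , wsi≡y) = right , proj₁ decoded , image , record
  { start     = start′
  ; balanced  = balanced-all x (right-balanced image start′ (balanced adm x))
  ; aperiodic = aperiodic adm ∘ image-eventuallyPeriodic (mor x right) image (nonerasing x right)
  ; ¬quasi    = ¬quasi adm ∘ image-quasiperiodic (mor x right) image (nonerasing x right)
  }
  where
  y = other x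

  x-isolated : ∀ j → w j ≡ x → w (suc j) ≡ y
  x-isolated j wj≡x = ≢⇒other λ wsj≡x → 1+n≰n (≤-trans
      (≤-reflexive (sym (trans (count-same x [ x ]) (cong suc (count-same x [])))))
    (≤-trans (balanced adm x (x ∷ x ∷ []) (y ∷ y ∷ []) (wj≡x , wsj≡x , tt) (wi≡y , wsi≡y , tt) ≤-refl)
      (≤-reflexive (cong suc (count-replicate-diff 2 (other≢ x))))))

  next : ∀ j → ⊤ → ∃[ z ] Occurs w j (mor x right z) × ⊤
  next j _ with same⊎other x (w j)
  ... | inj₁ e = x , subst (Occurs w j) (sym (right-same x)) (e , x-isolated j e , tt) , tt
  ... | inj₂ e = y , subst (Occurs w j) (sym (right-diff x)) (e , tt) , tt

  decoded : ∃[ w′ ] Image (apply (mor x right)) w′ w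
  decoded = decode (mor x right) w (λ _ → ⊤) tt next

  image = proj₂ decoded
  start′ = right-head image (start adm)
... | no ¬yy = left , proj₁ decoded , image , record
  { start     = start′
  ; balanced  = balanced-all (other x) (left-balanced image (balanced adm (other x)))
  ; aperiodic = aperiodic adm ∘ image-eventuallyPeriodic (mor x left) image (nonerasing x left)
  ; ¬quasi    = ¬quasi adm ∘ image-quasiperiodic (mor x left) image (nonerasing x left)
  }
  where
  y = other x

  y-isolated : ∀ j → w j ≡ y → w (suc j) ≡ x
  y-isolated j wj≡y with same⊎other x (w (suc j))
  ... | inj₁ e = e
  ... | inj₂ e = contradiction (j , wj≡y , e) ¬yy

  next : ∀ j → w j ≡ x → ∃[ z ] Occurs w j (mor x left z) × w (j + length (mor x left z)) ≡ x
  next j wj≡x with same⊎other x (w (suc j))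
  ... | inj₁ e = x , subst (λ u → Occurs w j u × w (j + length u) ≡ x) (sym (left-same x))
      ((wj≡x , tt) , trans (cong w (+-comm j 1)) e)
  ... | inj₂ e = y , subst (λ u → Occurs w j u × w (j + length u) ≡ x) (sym (left-diff x))
      ((wj≡x , e , tt) , trans (cong w (+-comm j 2)) (y-isolated (suc j) e))

  decoded : ∃[ w′ ] Image (apply (mor x left)) w′ w
  decoded = decode (mor x left) w (λ j → w j ≡ x) (start adm) next

  image = proj₂ decoded

  start′ : proj₁ decoded 0 ≡ x
  start′ with same⊎other x (proj₁ decoded 0)
  ... | inj₁ e = e
  ... | inj₂ e with subst (Occurs w 0) (trans (apply-[] (mor x left) y) (left-diff x)) (image [ y ] (e , tt))
  ...   | _ , w1≡y , _ = contradiction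
      (isolated-xy⇒quasiperiodic em (balanced adm) (aperiodic adm) y-isolated (start adm) w1≡y) (¬quasi adm)

-- Unbordered words

-- Here `v` is both a prefix and a suffix of `u`; the alternative `s ≡ []` means that `v` is all of
-- `u`.
Unbordered : Word → Set
Unbordered u = ∀ v {s p} → v ++ s ≡ u → p ++ v ≡ u → v ≡ [] ⊎ s ≡ []

-- In a quasiperiodic word, the occurrence of the quasiperiod that covers the end
-- of a long prefix makes this prefix bordered.
unbordered⇒¬quasiperiodic : ∀ {w} → (∀ k → ∃[ v ] k ≤ length v × Unbordered v × Occurs w 0 v) →
  ¬ Quasiperiodic w
unbordered⇒¬quasiperiodic {w} prefixes (u , p , p0≡[] , h) with prefixes (suc (length u))
-- Since `p n` has length at least n, some k has `p k` shorter than `v` and the next one not. The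
-- remainder `t` of `v` after `p k` lies inside the occurrence of `u` there, so it is a prefix of
-- `u`. As `u` is a prefix of `w`, `t` is also a prefix of `v`.
... | v , u<v , unb , ov with search (length v) (unbounded (length v))
  where
  unbounded : ∀ n → n ≤ length (p n)
  unbounded zero    = z≤n
  unbounded (suc n) = ≤-trans (s≤s (unbounded n)) (m∸n≢0⇒n<m λ eq → <⇒≢ (proj₁ (h n)) (sym eq))

  search : ∀ n → length v ≤ length (p n) → ∃[ k ] length (p k) < length v × length v ≤ length (p (suc k))
  search zero    v≤ = contradiction (≤-trans (≤-trans (s≤s z≤n) u<v)
      (≤-trans v≤ (≤-reflexive (cong length p0≡[])))) λ ()
  search (suc n) v≤ with length v ≤? length (p n)
  ... | yes v≤′ = search n v≤′
  ... | no v≰   = n , ≰⇒> v≰ , v≤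
... | k , pk<v , v≤ with ++-split v (<⇒≤ pk<v)
...   | v₁ , t , refl , v₁≡pk with occurs-extends t u ot ou t≤u
  where
  ot : Occurs w (length (p k)) t
  ot = subst (λ i → Occurs w i t) v₁≡pk (occurs-++⁻ʳ v₁ ov)

  ou : Occurs w (length (p k)) u
  ou = occurs-++⁻ʳ (p k) (prefix⇒occurs (proj₂ (proj₂ (h k))))

  t≤u : length t ≤ length u
  t≤u = +-cancelˡ-≤ (length (p k)) _ _ (begin
    length (p k) + length t                                 ≡⟨ cong (_+ length t) (sym v₁≡pk) ⟩
    length v₁ + length t                                    ≡⟨ sym (length-++ v₁) ⟩
    length (v₁ ++ t)                                        ≤⟨ v≤ ⟩
    length (p (suc k))                                      ≤⟨ m≤n+m∸n _ (length (p k)) ⟩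
    length (p k) + (length (p (suc k)) ∸ length (p k))      ≤⟨ +-monoʳ-≤ (length (p k))
        (proj₁ (proj₂ (h k))) ⟩
    length (p k) + length u                                 ∎)
    where open ≤-Reasoning
...     | r , u≡t++r with occurs-extends t (v₁ ++ t) ot₀ ov (subst (length t ≤_) (sym (length-++ v₁))
    (m≤n+m _ _))
  where
  ot₀ : Occurs w 0 t
  ot₀ = occurs-++⁻ˡ t (subst (Occurs w 0) (trans (cong (_++ u) p0≡[]) u≡t++r)
      (prefix⇒occurs (proj₂ (proj₂ (h 0)))))
...       | q , v≡t++q with unb t (sym v≡t++q) refl
...         | inj₁ refl = contradiction pk<v (≤⇒≯ (≤-reflexive (trans (cong length (++-identityʳ v₁)) v₁≡pk)))
...         | inj₂ refl with ++-identityˡ-unique v₁ (trans (sym (++-identityʳ t)) (sym v≡t++q))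
...           | refl = 1+n≰n (≤-trans u<v (subst (λ l → length t ≤ l) (cong length (sym u≡t++r))
    (length-++-≤ˡ t)))

-- Parsing images into the blocks x, y and xy

data EndsWith (z : Letter) : Word → Set where
  here  : EndsWith z (z ∷ [])
  there : ∀ {c u} → EndsWith z u → EndsWith z (c ∷ u)

endsWith-singleton : ∀ {z c} → EndsWith z (c ∷ []) → c ≡ z
endsWith-singleton here       = refl
endsWith-singleton (there ())

endsWith-tail : ∀ {z c u} → EndsWith z (c ∷ u) → u ≡ [] ⊎ EndsWith z u
endsWith-tail here      = inj₁ refl
endsWith-tail (there e) = inj₂ e

endsWith-++ : ∀ {z} u {v} → EndsWith z v → EndsWith z (u ++ v)
endsWith-++ []      e = e
endsWith-++ (c ∷ u) e = there (endsWith-++ u e)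

endsWith-suffix : ∀ {z} u {c v} → EndsWith z (u ++ c ∷ v) → EndsWith z (c ∷ v)
endsWith-suffix []          e         = e
endsWith-suffix (d ∷ [])    (there e) = e
endsWith-suffix (d ∷ c ∷ u) (there e) = endsWith-suffix (c ∷ u) e

-- Collects the values of both morphisms, so that parsing does not distinguish the sides.
data Block (x : Letter) : Word → Set where
  block-x  : Block x (x ∷ [])
  block-y  : Block x (other x ∷ [])
  block-xy : Block x (x ∷ other x ∷ [])

block : ∀ x s z → Block x (mor x s z)
block a left  a = block-x
block a left  b = block-xy
block a right a = block-xy
block a right b = block-y
block b left  a = block-xy
block b left  b = block-x
block b right a = block-y
block b right b = block-xy

-- A letter y can only end a block and a letter x can only begin one.
split-prefix : ∀ x s u v {r} → v ≡ [] ⊎ EndsWith (other x) v → apply (mor x s) u ≡ v ++ r →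
  ∃[ u₁ ] ∃[ u₂ ] u ≡ u₁ ++ u₂ × apply (mor x s) u₁ ≡ v × apply (mor x s) u₂ ≡ r
split-prefix x s u       []      _        eq = [] , u , refl , refl , eq
split-prefix x s []      (c ∷ v) _        ()
split-prefix x s (z ∷ u) (c ∷ v) (inj₂ e) eq with mor x s z in fz | block x s z
... | _ | block-x with split-prefix x s u v (endsWith-tail e) (∷-injectiveʳ eq)
...   | u₁ , u₂ , refl , refl , refl =
  z ∷ u₁ , u₂ , refl , trans (cong (_++ apply (mor x s) u₁) fz) (cong (_∷ _) (∷-injectiveˡ eq)) , refl
split-prefix x s (z ∷ u) (c ∷ v) (inj₂ e) eq | _ | block-y with split-prefix x s u v (endsWith-tail e)
    (∷-injectiveʳ eq)
...   | u₁ , u₂ , refl , refl , refl =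
  z ∷ u₁ , u₂ , refl , trans (cong (_++ apply (mor x s) u₁) fz) (cong (_∷ _) (∷-injectiveˡ eq)) , refl
split-prefix x s (z ∷ u) (c ∷ []) (inj₂ e) eq | _ | block-xy =
  contradiction (trans (sym (endsWith-singleton e)) (sym (∷-injectiveˡ eq))) (other≢ x)
split-prefix x s (z ∷ u) (c ∷ d ∷ v) (inj₂ (there e)) eq | _ | block-xy
  with split-prefix x s u v (endsWith-tail e) (∷-injectiveʳ (∷-injectiveʳ eq))
...   | u₁ , u₂ , refl , refl , refl =
  z ∷ u₁ , u₂ , refl , trans (cong (_++ apply (mor x s) u₁) fz)
      (cong₂ (λ c d → c ∷ d ∷ _) (∷-injectiveˡ eq) (∷-injectiveˡ (∷-injectiveʳ eq))) , refl

split-suffix : ∀ x s u p {v} → p ++ x ∷ v ≡ apply (mor x s) u →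
  ∃[ u₁ ] ∃[ u₂ ] u ≡ u₁ ++ u₂ × apply (mor x s) u₂ ≡ x ∷ v
split-suffix x s u       []      eq = [] , u , refl , sym eq
split-suffix x s []      (c ∷ p) ()
split-suffix x s (z ∷ u) (c ∷ p) eq with mor x s z | block x s z
... | _ | block-x with split-suffix x s u p (∷-injectiveʳ eq)
...   | u₁ , u₂ , refl , eq′ = z ∷ u₁ , u₂ , refl , eq′
split-suffix x s (z ∷ u) (c ∷ p) eq | _ | block-y with split-suffix x s u p (∷-injectiveʳ eq)
...   | u₁ , u₂ , refl , eq′ = z ∷ u₁ , u₂ , refl , eq′
split-suffix x s (z ∷ u) (c ∷ []) eq | _ | block-xy =
  contradiction (sym (∷-injectiveˡ (∷-injectiveʳ eq))) (other≢ x)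
split-suffix x s (z ∷ u) (c ∷ d ∷ p) eq | _ | block-xy with split-suffix x s u p
    (∷-injectiveʳ (∷-injectiveʳ eq))
... | u₁ , u₂ , refl , eq′ = z ∷ u₁ , u₂ , refl , eq′

left-no-y : ∀ x u {t} → apply (mor x left) u ≢ other x ∷ t
left-no-y x (z ∷ u) eq with mor x left z | left-head x z
... | _ | _ , refl = other≢ x (sym (∷-injectiveˡ eq))

-- For R_y the first letter identifies the first block. For L_x the letter after the initial x does:
-- a y belongs to the same block, because no block begins with y.
apply-injective : ∀ x s u v → apply (mor x s) u ≡ apply (mor x s) v → u ≡ v
apply-injective x s [] [] _ = refl
apply-injective x s [] (z ∷ v) eq with mor x s z | block x s z
apply-injective x s [] (z ∷ v) () | _ | block-x
apply-injective x s [] (z ∷ v) () | _ | block-y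
apply-injective x s [] (z ∷ v) () | _ | block-xy
apply-injective x s (z ∷ u) [] eq with mor x s z | block x s z
apply-injective x s (z ∷ u) [] () | _ | block-x
apply-injective x s (z ∷ u) [] () | _ | block-y
apply-injective x s (z ∷ u) [] () | _ | block-xy
apply-injective x left (z ∷ u) (c ∷ v) eq with view x z | view x c
... | same | same rewrite left-same x = cong (x ∷_) (apply-injective x left u v (∷-injectiveʳ eq))
... | same | diff rewrite left-same x | left-diff x = contradiction (∷-injectiveʳ eq) (left-no-y x u)
... | diff | same rewrite left-same x | left-diff x = contradiction (sym (∷-injectiveʳ eq)) (left-no-y x v)
... | diff | diff rewrite left-diff x = cong (other x ∷_)
    (apply-injective x left u v (∷-injectiveʳ (∷-injectiveʳ eq)))
apply-injective x right (z ∷ u) (c ∷ v) eq with view x z | view x c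
... | same | same rewrite right-same x = cong (x ∷_)
    (apply-injective x right u v (∷-injectiveʳ (∷-injectiveʳ eq)))
... | same | diff rewrite right-same x | right-diff x = contradiction (sym (∷-injectiveˡ eq)) (other≢ x)
... | diff | same rewrite right-same x | right-diff x = contradiction (∷-injectiveˡ eq) (other≢ x)
... | diff | diff rewrite right-diff x = cong (other x ∷_) (apply-injective x right u v (∷-injectiveʳ eq))

mor-head : ∀ x s → ∃[ t ] mor x s x ≡ x ∷ t
mor-head x left  = [] , left-same x
mor-head x right = [ other x ] , right-same x

mor-last : ∀ x s → EndsWith (other x) (mor x s (other x))
mor-last x left  rewrite left-diff x  = there here
mor-last x right rewrite right-diff x = here

apply-last : ∀ x s {u} → EndsWith (other x) u → EndsWith (other x) (apply (mor x s) u)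
apply-last x s here = subst (EndsWith (other x)) (sym (apply-[] (mor x s) (other x))) (mor-last x s)
apply-last x s (there {c} e) = endsWith-++ (mor x s c) (apply-last x s e)

data Shape (x : Letter) : Word → Set where
  letter     : ∀ z → Shape x [ z ]
  unbordered : ∀ {t} → EndsWith (other x) (x ∷ t) → Unbordered (x ∷ t) → Shape x (x ∷ t)

shape⇒unbordered : ∀ {x u} → Shape x u → Unbordered u
shape⇒unbordered (letter z)         []      _  _ = inj₁ refl
shape⇒unbordered (letter z)         (c ∷ v) eq _ = inj₂ (++-conicalʳ v _ (∷-injectiveʳ eq))
shape⇒unbordered (unbordered _ unb) = unb

xy-unbordered : ∀ x → Unbordered (x ∷ other x ∷ [])
xy-unbordered x []              _    _ = inj₁ refl
xy-unbordered x (c ∷ [])        {p = []}        eq ()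
xy-unbordered x (c ∷ [])        {p = d ∷ []}    eq eq′ =
  contradiction (trans (sym (∷-injectiveˡ (∷-injectiveʳ eq′))) (∷-injectiveˡ eq)) (other≢ x)
xy-unbordered x (c ∷ [])        {p = d ∷ e ∷ []} eq ()
xy-unbordered x (c ∷ [])        {p = d ∷ e ∷ f ∷ p} eq ()
xy-unbordered x (c ∷ d ∷ [])    {[]} _ _ = inj₂ refl
xy-unbordered x (c ∷ d ∷ [])    {_ ∷ _} ()
xy-unbordered x (c ∷ d ∷ e ∷ v) ()

-- A nonempty border of the image of x t begins with x and ends with y, so it respects block
-- boundaries both as a prefix and as a suffix. By injectivity its two preimages agree and form a
-- border of x t.
apply-shape : ∀ x s {u} → Shape x u → Shape x (apply (mor x s) u)
apply-shape x s (letter z) = subst (Shape x) (sym (apply-[] (mor x s) z)) (shape (block x s z))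
  where
  shape : ∀ {u} → Block x u → Shape x u
  shape block-x  = letter x
  shape block-y  = letter (other x)
  shape block-xy = unbordered (there here) (xy-unbordered x)
apply-shape x s (unbordered {t} e unb) with mor-head x s
... | t₀ , fx≡ = subst (Shape x) (sym fu≡) (unbordered
  (subst (EndsWith (other x)) fu≡ fe) (subst Unbordered fu≡ unb′))
  where
  f = mor x s

  fu≡ : apply f (x ∷ t) ≡ x ∷ t₀ ++ apply f t
  fu≡ = cong (_++ apply f t) fx≡

  fe : EndsWith (other x) (apply f (x ∷ t))
  fe = apply-last x s e

  unb′ : Unbordered (apply f (x ∷ t))
  unb′ []      _ _ = inj₁ refl
  unb′ (c ∷ v) {r} {p} pre suf with ∷-injectiveˡ (trans pre fu≡)
  ... | refl with split-prefix x s (x ∷ t) (x ∷ v)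
      (inj₂ (endsWith-suffix p (subst (EndsWith (other x)) (sym suf) fe))) (sym pre)
                | split-suffix x s (x ∷ t) p suf
  ...   | u₁ , u₂ , u≡ , fu₁ , fu₂ | u₃ , u₄ , u≡′ , fu₄ with apply-injective x s u₁ u₄ (trans fu₁ (sym fu₄))
  ...     | refl with unb u₁ {u₂} {u₃} (sym u≡) (sym u≡′)
  ...       | inj₁ u₁≡[] = contradiction (trans (sym fu₁) (cong (apply f) u₁≡[])) λ ()
  ...       | inj₂ u₂≡[] = inj₂ (trans (sym fu₂) (cong (apply f) u₂≡[]))

-- Compositions of substitutions

-- The properties that survive composition, so that single morphisms, their powers and the
-- alternating factors can be treated alike.
record Substitution (x : Letter) (F : Endo) : Set where
  field
    homo      : ∀ u v → F (u ++ v) ≡ F u ++ F v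
    expanding : ∀ u → length u ≤ length (F u)
    head      : ∃[ t ] F [ x ] ≡ x ∷ t
    shape     : ∀ {u} → Shape x u → Shape x (F u)

open Substitution

mor-substitution : ∀ x s → Substitution x (apply (mor x s))
mor-substitution x s = record
  { homo      = apply-++ (mor x s)
  ; expanding = length-apply (mor x s) (nonerasing x s)
  ; head      = proj₁ (mor-head x s) , trans (apply-[] (mor x s) x) (proj₂ (mor-head x s))
  ; shape     = apply-shape x s
  }

id-substitution : ∀ {x} → Substitution x id
id-substitution = record
  { homo = λ _ _ → refl ; expanding = λ _ → ≤-refl ; head = [] , refl ; shape = id }

infixr 9 _∘ˢ_

_∘ˢ_ : ∀ {x F G} → Substitution x F → Substitution x G → Substitution x (F ∘ G)
_∘ˢ_ {x} {F} {G} σ τ = record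
  { homo      = λ u v → trans (cong F (homo τ u v)) (homo σ (G u) (G v))
  ; expanding = λ u → ≤-trans (expanding τ u) (expanding σ (G u))
  ; head      = _ , trans (cong F (proj₂ (head τ))) (trans (homo σ [ x ] (proj₁ (head τ)))
                      (cong (_++ F (proj₁ (head τ))) (proj₂ (head σ))))
  ; shape     = shape σ ∘ shape τ
  }

^-substitution : ∀ {x F} → Substitution x F → ∀ d → Substitution x (F ^ d)
^-substitution σ zero    = id-substitution
^-substitution σ (suc d) = σ ∘ˢ ^-substitution σ d

composite-substitution : ∀ {x F} → (∀ n → Substitution x (F n)) → ∀ n → Substitution x (composite F n)
composite-substitution σ zero    = id-substitution
composite-substitution σ (suc n) = σ 0 ∘ˢ composite-substitution (σ ∘ suc) n

composite-+ : ∀ F m n u → composite F (m + n) u ≡ composite F m (composite (λ i → F (m + i)) n u)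
composite-+ F zero    n u = refl
composite-+ F (suc m) n u = cong (F 0) (composite-+ (F ∘ suc) m n u)

composite-suc : ∀ F n u → composite F (suc n) u ≡ composite F n (F n u)
composite-suc F zero    u = refl
composite-suc F (suc n) u = cong (F 0) (composite-suc (F ∘ suc) n u)

Frequently : (ℕ → Set) → Set
Frequently P = ∀ n → ∃[ m ] n ≤ m × P m

module _ {x : Letter} {F : ℕ → Endo} (σ : ∀ n → Substitution x (F n)) where

  seed-head : ∀ n u {t} → u ≡ x ∷ t → ∃[ r ] composite F n u ≡ composite F n [ x ] ++ r
  seed-head n u {t} refl = composite F n t , homo (composite-substitution σ n) [ x ] t

  -- The inner factors send x to a word beginning with x; hence the composites applied to x form a
  -- chain of prefixes.
  composite-head : ∀ m n → ∃[ r ] composite F (m + n) [ x ] ≡ composite F m [ x ] ++ r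
  composite-head m n with seed-head m _ (proj₂ (head (composite-substitution (λ i → σ (m + i)) n)))
  ... | r , eq = r , trans (composite-+ F m n [ x ]) eq

  composite-monotone : ∀ {m n} → m ≤ n → length (composite F m [ x ]) ≤ length (composite F n [ x ])
  composite-monotone {m} {n} m≤n with composite-head m (n ∸ m)
  ... | r , eq = ≤-trans (≤-trans (m≤m+n _ (length r)) (≤-reflexive (sym (length-++ (composite F m [ x ])))))
                   (≤-reflexive (trans (cong length (sym eq)) (cong (λ k → length (composite F k [ x ]))
                       (m+[n∸m]≡n m≤n))))

  -- Whenever `F m` maps x to a word with a second letter, the outer composite adds a nonempty image
  -- of it.
  composite-grows : Frequently (λ m → 2 ≤ length (F m [ x ])) → ∀ k → ∃[ n ] k ≤ length (composite F n [ x ])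
  composite-grows grow zero    = 0 , z≤n
  composite-grows grow (suc k) with composite-grows grow k
  ... | n , k≤ with grow n
  ...   | m , n≤m , 2≤ with F m [ x ] in Fx≡ | head (σ m) | 2≤
  ...     | _ | []    , refl | s≤s ()
  ...     | _ | c ∷ t , refl | _ = suc m , (begin
    suc k                                                      ≡⟨ +-comm 1 k ⟩
    k + 1                                                      ≤⟨ +-mono-≤
        (≤-trans k≤ (composite-monotone n≤m)) (≤-trans (s≤s z≤n) (expanding C (c ∷ t))) ⟩
    length (composite F m [ x ]) + length (composite F m (c ∷ t)) ≡⟨ sym (length-++ (composite F m [ x ])) ⟩
    length (composite F m [ x ] ++ composite F m (c ∷ t))      ≡⟨ cong length (sym (homo C [ x ] (c ∷ t))) ⟩
    length (composite F m (x ∷ c ∷ t))                         ≡⟨ cong (length ∘ composite F m) (sym Fx≡) ⟩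
    length (composite F m (F m [ x ]))                         ≡⟨ cong length
        (sym (composite-suc F m [ x ])) ⟩
    length (composite F (suc m) [ x ])                         ∎)
    where
    C = composite-substitution σ m
    open ≤-Reasoning

  -- A seed other than x is harmless as soon as some later substitution maps both
  -- letters to words beginning with x.
  composite-limit : ∀ {W : ℕ → InfWord} → (∀ n → Image (F n) (W (suc n)) (W n)) → (∀ n → W n 0 ≡ x) →
    Frequently (λ m → 2 ≤ length (F m [ x ])) → Frequently (λ m → ∀ z → ∃[ t ] F m [ z ] ≡ x ∷ t) →
    ∀ s → IsLimitOf (W 0) (λ n → composite F n [ s ])
  composite-limit {W} images starts grow reset s k with composite-grows grow k
  ... | n , k≤ with reset n
  -- From index `suc m` on, the composite `F 0` to `F (m - 1)` is applied to a word that begins with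
  -- x, whatever the seed.
  ...   | m , n≤m , resets = suc m , λ p m<p → agrees p (split p m<p)
    where
    image : ∀ {W : ℕ → InfWord} {F} → (∀ n → Image (F n) (W (suc n)) (W n)) → ∀ n →
        Image (composite F n) (W n) (W 0)
    image h zero    u o = o
    image h (suc n) u o = h 0 _ (image (h ∘ suc) n u o)

    split : ∀ p → suc m ≤ p → ∃[ r ] composite F p [ s ] ≡ composite F m [ x ] ++ r
    split p m<p = let r , eq = seed-head m _ (proj₂ starts-x) in
      r , trans (cong (λ k → composite F k [ s ]) (sym p≡)) (trans (composite-+ F m (suc q) [ s ]) eq)
      where
      q = p ∸ suc m
      G = λ i → F (m + i)

      p≡ : m + suc q ≡ p
      p≡ = trans (+-suc m q) (m+[n∸m]≡n m<p)

      resets′ : ∀ u → 1 ≤ length u → ∃[ t ] F (m + 0) u ≡ x ∷ t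
      resets′ (c ∷ u) _ rewrite +-identityʳ m =
        _ , trans (homo (σ m) [ c ] u) (cong (_++ F m u) (proj₂ (resets c)))

      starts-x : ∃[ t ] composite G (suc q) [ s ] ≡ x ∷ t
      starts-x = resets′ (composite (G ∘ suc) q [ s ])
        (expanding (composite-substitution (λ i → σ (m + suc i)) q) [ s ])

    agrees : ∀ p → (∃[ r ] composite F p [ s ] ≡ composite F m [ x ] ++ r) →
      k ≤ length (composite F p [ s ]) × take k (composite F p [ s ]) ≡ prefixOfLength k (W 0)
    agrees p (r , eq) = subst (λ u → k ≤ length u × take k u ≡ prefixOfLength k (W 0)) (sym eq)
      ( ≤-trans k≤′ (≤-trans (m≤m+n _ (length r)) (≤-reflexive (sym (length-++ (composite F m [ x ])))))
      , trans (take-++ˡ k (composite F m [ x ]) r k≤′) (trans (occurs-take k _ occ k≤′)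
          (segment-prefix (W 0) k)))
      where
      k≤′ : k ≤ length (composite F m [ x ])
      k≤′ = ≤-trans k≤ (composite-monotone n≤m)

      occ : Occurs (W 0) 0 (composite F m [ x ])
      occ = image {W} images m [ x ] (starts m , tt)

  -- The factors after the first n turn the seed into a word of `Shape x`. It either begins with x,
  -- which gives the prefix, or is the single letter y. The latter is excluded by asking for more
  -- letters than the image of y has.
  limit-prefix : ∀ {w s} → IsLimitOf w (λ n → composite F n [ s ]) → ∀ n → Occurs w 0 (composite F n [ x ])
  limit-prefix {w} {s} lim n with lim (length (composite F n [ x ]) +
      suc (length (composite F n [ other x ])))
  ... | N , h with h (n + N) (m≤n+m N n)
  ...   | k≤ , take≡ rewrite composite-+ F n N [ s ]
    with composite (λ i → F (n + i)) N [ s ] | shape (composite-substitution (λ i → σ (n + i)) N) (letter s)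
  ... | _ | letter z with same⊎other x z
  ...   | inj₁ refl = take⇒occurs (composite F n [ x ]) [] (trans (cong (take _) (++-identityʳ _)) take≡)
  ...   | inj₂ refl = contradiction (≤-trans (m≤n+m _ (length (composite F n [ x ]))) k≤) 1+n≰n
  limit-prefix {w} {s} lim n | N , h | k≤ , take≡ | _ | unbordered {t} _ _ =
    take⇒occurs (composite F n [ x ]) (composite F n t)
        (trans (cong (take _) (sym (homo (composite-substitution σ n) [ x ] t))) take≡)

  limit⇒¬quasiperiodic : ∀ {w s} → IsLimitOf w (λ n → composite F n [ s ]) →
    Frequently (λ m → 2 ≤ length (F m [ x ])) → ¬ Quasiperiodic w
  limit⇒¬quasiperiodic lim grow = unbordered⇒¬quasiperiodic λ k →
    let n , k≤ = composite-grows grow k in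
    composite F n [ x ] , k≤ , shape⇒unbordered (shape (composite-substitution σ n) (letter x)) ,
        limit-prefix lim n

-- From non-quasiperiodicity to decompositions

flip : Side → Side
flip left  = right
flip right = left

_≟ˢ_ : (s t : Side) → Dec (s ≡ t)
left  ≟ˢ left  = yes refl
left  ≟ˢ right = no λ ()
right ≟ˢ left  = no λ ()
right ≟ˢ right = yes refl

≢⇒flip : ∀ {s t} → s ≢ t → s ≡ flip t
≢⇒flip {left}  {left}  s≢t = contradiction refl s≢t
≢⇒flip {left}  {right} _   = refl
≢⇒flip {right} {left}  _   = refl
≢⇒flip {right} {right} s≢t = contradiction refl s≢t

flip≢ : ∀ s → flip s ≢ s
flip≢ left  ()
flip≢ right ()

-- A prefix of every word that starts with x after j desubstitutions on the same side.
runPrefix : Letter → Side → ℕ → Word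
runPrefix x left  j = replicate j x
runPrefix x right j = x ∷ replicate j (other x)

runPrefix-zero : ∀ x s {w} → w 0 ≡ x → Occurs w 0 (runPrefix x s 0)
runPrefix-zero x left  _    = tt
runPrefix-zero x right w0≡x = w0≡x , tt

-- L_x fixes x^j, and the block after it contributes one more x; R_y maps x y^j to x y^(j+1).
runPrefix-suc : ∀ x s {w′ w} j → Image (apply (mor x s)) w′ w →
  Occurs w′ 0 (runPrefix x s j) → Occurs w 0 (runPrefix x s (suc j))
runPrefix-suc x left {w′} {w} j image o with left-head x (w′ j)
... | t , fz≡ = occurs-replicate j (occurs-++⁻ˡ (replicate j x) occ)
    (trans (cong w (sym (length-replicate j))) (proj₁ (occurs-++⁻ʳ (replicate j x) occ)))
  where
  f = mor x left

  powers : ∀ j → apply f (replicate j x) ≡ replicate j x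
  powers zero    = refl
  powers (suc j) = cong₂ _++_ (left-same x) (powers j)

  occ : Occurs w 0 (replicate j x ++ x ∷ t)
  occ = subst (Occurs w 0)
    (trans (apply-++ f (replicate j x) [ w′ j ]) (cong₂ _++_ (powers j) (trans (apply-[] f (w′ j)) fz≡)))
    (image (replicate j x ++ [ w′ j ]) (occurs-++⁺ (replicate j x) o (cong w′ (length-replicate j) , tt)))
runPrefix-suc x right {w′} {w} j image o =
  subst (Occurs w 0) (cong₂ _++_ (right-same x) (powers j)) (image (x ∷ replicate j (other x)) o)
  where
  powers : ∀ j → apply (mor x right) (replicate j (other x)) ≡ replicate j (other x)
  powers zero    = refl
  powers (suc j) = cong₂ _++_ (right-diff x) (powers j)

runPrefix⇒eventuallyPeriodic : ∀ x s {w} → (∀ j → Occurs w 0 (runPrefix x s j)) → EventuallyPeriodic w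
runPrefix⇒eventuallyPeriodic x left h = 0 , 1 , s≤s z≤n , λ k →
  trans (replicate-lookup (suc k) (h (suc k)) ≤-refl) (sym (replicate-lookup (2 + k) (h (2 + k)) ≤-refl))
runPrefix⇒eventuallyPeriodic x right h = 1 , 2 , s≤s (s≤s z≤n) , λ k →
  trans (replicate-lookup (suc k) (proj₂ (h (suc k))) ≤-refl)
        (sym (replicate-lookup (2 + k) (proj₂ (h (2 + k))) ≤-refl))

-- Provides the words beginning with x that `composite-limit` needs to forget the seed.
left-power-head : ∀ x {d} u → 1 ≤ d → 1 ≤ length u → ∃[ t ] (apply (mor x left) ^ d) u ≡ x ∷ t
left-power-head x {suc d} u _ 1≤u
  with (apply (mor x left) ^ d) u | expanding (^-substitution (mor-substitution x left) d) u
... | []    | ≤0 = contradiction (≤-trans 1≤u ≤0) λ ()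
... | c ∷ v | _  = proj₁ (left-head x c) ++ apply (mor x left) v , cong (_++ apply (mor x left) v)
    (proj₂ (left-head x c))

right-expands : ∀ x → length (mor x right x) ≡ 2
right-expands x = cong length (right-same x)

right-power-expands : ∀ x {d} → 1 ≤ d → 2 ≤ length ((apply (mor x right) ^ d) [ x ])
right-power-expands x {suc d} _ with head (^-substitution (mor-substitution x right) d)
... | t , eq rewrite eq = subst (2 ≤_) (sym (length-++ (mor x right x)))
  (≤-trans (≤-reflexive (sym (right-expands x))) (m≤m+n _ _))

-- For x = a and x = b these unfold to the factors of `alternating La Rb d` and
-- `alternating Lb Ra d`.
Alternation : Letter → (ℕ → ℕ) → ℕ → Endo
Alternation x d i = (apply (mor x left) ^ d (2 * i)) ∘ (apply (mor x right) ^ d (2 * i + 1))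

alternation-substitution : ∀ x d i → Substitution x (Alternation x d i)
alternation-substitution x d i =
  ^-substitution (mor-substitution x left) (d (2 * i)) ∘ˢ ^-substitution (mor-substitution x right)
      (d (2 * i + 1))

alternation-expands : ∀ x d → (∀ k → 1 ≤ d (suc k)) → ∀ i → 2 ≤ length (Alternation x d i [ x ])
alternation-expands x d d≥1 i = ≤-trans
  (right-power-expands x (subst (λ k → 1 ≤ d k) (+-comm 1 (2 * i)) (d≥1 (2 * i))))
  (expanding (^-substitution (mor-substitution x left) (d (2 * i))) _)

module _ (em : ExcludedMiddle 0ℓ) {x : Letter} {w : InfWord} (adm : Admissible x w) where

  private
    state : ℕ → Σ[ w ∈ InfWord ] Admissible x w
    state zero    = w , adm
    state (suc n) = let _ , w′ , _ , adm′ = step em (proj₂ (state n)) in w′ , adm′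

    W : ℕ → InfWord
    W n = proj₁ (state n)

    κ : ℕ → Side
    κ n = proj₁ (step em (proj₂ (state n)))

    images : ∀ n → Image (apply (mor x (κ n))) (W (suc n)) (W n)
    images n = let _ , _ , image , _ = step em (proj₂ (state n)) in image

    starts : ∀ n → W n 0 ≡ x
    starts n = start (proj₂ (state n))

    -- If side `s` lasted for j steps from n, `runPrefix x s j` would occur at the start of `W n`.
    -- By aperiodicity this fails for some j, which bounds the search. The length `d` may be 0.
    run : ∀ s n → ∃[ d ] (∀ i → i < d → κ (n + i) ≡ s) × κ (n + d) ≡ flip s
    run s n = let j , ¬o = ¬∀⇒∃¬ em (aperiodic (proj₂ (state n)) ∘ runPrefix⇒eventuallyPeriodic x s) in
      search j n ¬o
      where
      search : ∀ j n → ¬ Occurs (W n) 0 (runPrefix x s j) → ∃[ d ] (∀ i → i < d → κ (n + i) ≡ s) ×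
          κ (n + d) ≡ flip s
      search zero    n ¬o = contradiction (runPrefix-zero x s (starts n)) ¬o
      search (suc j) n ¬o with κ n ≟ˢ s
      ... | no κ≢s = 0 , (λ _ ()) , trans (cong κ (+-identityʳ n)) (≢⇒flip κ≢s)
      ... | yes κ≡s with search j (suc n) (¬o ∘ runPrefix-suc x s j
          (subst (λ t → Image (apply (mor x t)) (W (suc n)) (W n)) κ≡s (images n)))
      ...   | d , same-side , flipped = suc d , same-side′ , trans (cong κ (+-suc n d)) flipped
        where
        same-side′ : ∀ i → i < suc d → κ (n + i) ≡ s
        same-side′ zero    _         = trans (cong κ (+-identityʳ n)) κ≡s
        same-side′ (suc i) (s≤s i<d) = trans (cong κ (+-suc n i)) (same-side i i<d)

    frequently : ∀ s {P : ℕ → Set} → (∀ m → κ m ≡ flip s → P m) → Frequently P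
    frequently s h n = let d , _ , flipped = run s n in n + d , m≤m+n n d , h (n + d) flipped

  -- All seeds are covered because the theorem uses the seed `a` even when x is `b`.
  decompose : ∃[ κ ] ∀ z → IsLimitOf w (λ n → composite (λ i → apply (mor x (κ i))) n [ z ])
  decompose = κ , composite-limit (λ n → mor-substitution x (κ n)) {W} images starts
    (frequently left λ m eq → subst (λ s → 2 ≤ length (apply (mor x s) [ x ])) (sym eq)
        (right-power-expands x {1} ≤-refl))
    (frequently right λ m eq z → subst (λ s → ∃[ t ] apply (mor x s) [ z ] ≡ x ∷ t) (sym eq)
        (left-power-head x {1} [ z ] ≤-refl (s≤s z≤n)))

  -- The sequence of sides is cut into maximal runs, starting with a possibly empty run of `left`.
  alternate : ∃[ d ] (∀ k → 1 ≤ d (suc k)) × (∀ z → IsLimitOf w (λ n → composite (Alternation x d) n [ z ]))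
  alternate = d , d≥1 , composite-limit (alternation-substitution x d) {λ i → W (pos (2 * i))} image
      (λ i → starts (pos (2 * i)))
    (λ n → n , ≤-refl , alternation-expands x d d≥1 n)
    -- The index is `suc n` since `d 0` may be 0, whereas the power of L_x in every later factor is
    -- positive.
    (λ n → suc n , n≤1+n n , λ z → left-power-head x ((apply (mor x right) ^ d (2 * suc n + 1)) [ z ])
        (d≥1 (n + 1 * suc n))
      (expanding (^-substitution (mor-substitution x right) (d (2 * suc n + 1))) [ z ]))
    where
    side : ℕ → Side
    side zero    = left
    side (suc k) = flip (side k)

    pos : ℕ → ℕ
    pos zero    = 0
    pos (suc k) = pos k + proj₁ (run (side k) (pos k))

    d : ℕ → ℕ
    d k = proj₁ (run (side k) (pos k))

    d≥1 : ∀ k → 1 ≤ d (suc k)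
    -- Run k stops at a step whose side is that of run k + 1, so the latter is not empty.
    d≥1 k = n≢0⇒n>0 λ d≡0 → flip≢ (side (suc k))
        (trans (sym (proj₂ (proj₂ (run (side (suc k)) (pos (suc k))))))
      (trans (cong (λ e → κ (pos (suc k) + e)) d≡0) (trans (cong κ (+-identityʳ (pos (suc k))))
        (proj₂ (proj₂ (run (side k) (pos k)))))))

    side-even : ∀ i → side (2 * i) ≡ left
    side-even zero    = refl
    side-even (suc i) = trans (cong side (*-suc 2 i)) (cong (flip ∘ flip) (side-even i))

    power-image : ∀ s d n → (∀ i → i < d → κ (n + i) ≡ s) → Image (apply (mor x s) ^ d) (W (n + d)) (W n)
    power-image s zero    n _ u o = subst (λ k → Occurs (W k) 0 u) (+-identityʳ n) o
    power-image s (suc d) n h u o =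
      subst (λ t → Image (apply (mor x t)) (W (suc n)) (W n)) (trans (cong κ (sym (+-identityʳ n)))
          (h 0 (s≤s z≤n))) (images n) _
        (power-image s d (suc n) (λ i i<d → trans (cong κ (sym (+-suc n i))) (h (suc i) (s≤s i<d))) u
          (subst (λ k → Occurs (W k) 0 u) (+-suc n d) o))

    run-image : ∀ k {s} → side k ≡ s → Image (apply (mor x s) ^ d k) (W (pos (suc k))) (W (pos k))
    run-image k refl = power-image (side k) (d k) (pos k) (proj₁ (proj₂ (run (side k) (pos k))))

    image : ∀ i → Image (Alternation x d i) (W (pos (2 * suc i))) (W (pos (2 * i)))
    image i u o = run-image (2 * i) (side-even i) _
      (subst (λ k → Occurs (W (pos (suc (2 * i)))) 0 ((apply (mor x right) ^ d k) u)) (+-comm 1 (2 * i))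
        (run-image (suc (2 * i)) (cong flip (side-even i)) u (subst (λ k → Occurs (W (pos k)) 0 u)
            (*-suc 2 i) o)))

-- From decompositions to non-quasiperiodicity

frequently⊎eventually : ExcludedMiddle 0ℓ → (P : ℕ → Set) → Frequently P ⊎ ∃[ n ] ∀ m → n ≤ m → ¬ P m
frequently⊎eventually em P with em {∃[ n ] ∀ m → n ≤ m → ¬ P m}
... | yes eventually = inj₂ eventually
... | no ¬eventually = inj₁ λ n → find n em
  where
  find : ∀ n → Dec (∃[ m ] n ≤ m × P m) → ∃[ m ] n ≤ m × P m
  find n (yes ∃m) = ∃m
  find n (no ¬∃m) = contradiction (n , λ m n≤m p → ¬∃m (m , n≤m , p)) ¬eventually

module _ {x : Letter} {f : ℕ → Morphism} (over : ∀ i → mor x left ≡ f i ⊎ mor x right ≡ f i) where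

  private
    σ : ∀ i → Substitution x (apply (f i))
    σ i with over i
    ... | inj₁ eq = subst (Substitution x ∘ apply) eq (mor-substitution x left)
    ... | inj₂ eq = subst (Substitution x ∘ apply) eq (mor-substitution x right)

  -- Powers of L_x fix x and map y to x^j y. With `C` the first n factors, the seed x would give
  -- words of bounded length, and the seed y makes every C(x^j) a prefix of `w`. So `w` is the
  -- infinite power of C(x).
  eventually-left⇒eventuallyPeriodic : ∀ {w z n} → IsLimitOf w (λ n → composite (apply ∘ f) n [ z ]) →
    (∀ m → n ≤ m → mor x left ≡ f m) → EventuallyPeriodic w
  eventually-left⇒eventuallyPeriodic {w} {z} {n} lim lefts =
    0 , length (C [ x ]) , expanding γ [ x ] , λ k →
      occurs-agree (C (replicate (suc k) x)) (occ (suc k))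
        (occurs-++⁻ʳ (C [ x ]) (subst (Occurs w 0) (homo γ [ x ] (replicate (suc k) x)) (occ (2 + k))))
        (≤-trans (≤-reflexive (cong suc (sym (length-replicate k)))) (expanding γ (replicate (suc k) x)))
    where
    y = other x
    C = composite (apply ∘ f) n
    γ = composite-substitution σ n
    g = λ i → apply (f (n + i))

    g-letter : ∀ j z → g j [ z ] ≡ mor x left z
    g-letter j z = trans (cong (λ h → apply h [ z ]) (sym (lefts (n + j) (m≤m+n n j))))
        (apply-[] (mor x left) z)

    power-x : ∀ j → composite g j [ x ] ≡ [ x ]
    power-x zero    = refl
    power-x (suc j) = trans (composite-suc g j [ x ])
      (trans (cong (composite g j) (trans (g-letter j x) (left-same x))) (power-x j))

    power-y : ∀ j → composite g j [ y ] ≡ replicate j x ++ [ y ]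
    power-y zero    = refl
    power-y (suc j) = trans (composite-suc g j [ y ])
      (trans (cong (composite g j) (trans (g-letter j y) (left-diff x)))
        (trans (homo (composite-substitution (λ i → σ (n + i)) j) [ x ] [ y ])
            (cong₂ _++_ (power-x j) (power-y j))))

    occ : ∀ j → Occurs w 0 (C (replicate j x))
    occ j with lim (length (C (replicate j x)) + suc (length (C [ x ])))
    ... | N , h with h (n + (j + N)) (≤-trans (m≤n+m N j) (m≤n+m (j + N) n)) | same⊎other x z
    ...   | k≤ , _ | inj₁ refl = contradiction
      (≤-trans (≤-trans (m≤n+m _ (length (C (replicate j x)))) k≤)
        (≤-reflexive (cong length (trans (composite-+ (apply ∘ f) n (j + N) [ x ])
            (cong C (power-x (j + N)))))))
      1+n≰n
    ...   | _ , take≡ | inj₂ refl = take⇒occurs (C (replicate j x)) (C (replicate N x ++ [ y ]))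
      (trans (cong (take _) (sym (trans (composite-+ (apply ∘ f) n (j + N) [ y ])
        (trans (cong C (trans (power-y (j + N)) (trans (cong (_++ [ y ]) (replicate-+ j N))
            (++-assoc (replicate j x) _ _))))
          (homo γ (replicate j x) (replicate N x ++ [ y ])))))) take≡)
      where
      replicate-+ : ∀ m n → replicate (m + n) x ≡ replicate m x ++ replicate n x
      replicate-+ zero    n = refl
      replicate-+ (suc m) n = cong (x ∷_) (replicate-+ m n)

  -- A factor lengthens x exactly when it is R_y. Either this happens infinitely often, or only L_x
  -- remains from some point on and `w` is periodic.
  decomposed⇒¬quasiperiodic : ExcludedMiddle 0ℓ → ∀ {w z} → ¬ EventuallyPeriodic w →
    IsLimitOf w (λ n → composite (apply ∘ f) n [ z ]) → ¬ Quasiperiodic w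
  decomposed⇒¬quasiperiodic em aper lim
    with frequently⊎eventually em (λ m → 2 ≤ length (apply (f m) [ x ]))
  ... | inj₁ grow          = limit⇒¬quasiperiodic σ lim grow
  ... | inj₂ (n , stagnant) = contradiction (eventually-left⇒eventuallyPeriodic lim lefts) aper
    where
    lefts : ∀ m → n ≤ m → mor x left ≡ f m
    lefts m n≤m with over m
    ... | inj₁ eq = eq
    ... | inj₂ eq = contradiction
      (subst (λ h → 2 ≤ length (apply h [ x ])) eq (right-power-expands x {1} ≤-refl)) (stagnant m n≤m)

alternating⇒¬quasiperiodic : ∀ x d {w z} → (∀ k → 1 ≤ d (suc k)) →
  IsLimitOf w (λ n → composite (Alternation x d) n [ z ]) → ¬ Quasiperiodic w
alternating⇒¬quasiperiodic x d d≥1 lim =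
  limit⇒¬quasiperiodic (alternation-substitution x d) lim λ n → n , ≤-refl , alternation-expands x d d≥1 n

theorem5p6 : ExcludedMiddle 0ℓ → (w : InfWord) → Sturmian w →
    ((¬ Quasiperiodic w) ⇔
    (InfinitelyDecomposableOver (｛ La ｝ ∪ ｛ Rb ｝) w ⊎
    InfinitelyDecomposableOver (｛ Lb ｝ ∪ ｛ Ra ｝) w))
    ×
    ((¬ Quasiperiodic w) ⇔
    (∃[ d ] (∀ k → 1 ≤ d (suc k)) ×
    (IsLimitOf w (alternating La Rb d) ⊎
    IsLimitOf w (alternating Lb Ra d))))
theorem5p6 em w (bal , ¬periodic) = mk⇔ decomposable ¬quasi₁ , mk⇔ alternates ¬quasi₂
  where
  aper : ¬ EventuallyPeriodic w
  aper = ¬periodic ∘ eventuallyPeriodic⇒ultimatelyPeriodic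

  admissible : ¬ Quasiperiodic w → ∀ {x} → w 0 ≡ x → Admissible x w
  admissible ¬q eq = record
    { start = eq ; balanced = balanced-all a (balanced⇒balancedFor-a bal) ; aperiodic = aper ; ¬quasi = ¬q }

  decomposable : ¬ Quasiperiodic w →
    InfinitelyDecomposableOver (｛ La ｝ ∪ ｛ Rb ｝) w ⊎ InfinitelyDecomposableOver (｛ Lb ｝ ∪ ｛ Ra ｝) w
  -- The letter x of the construction is the first letter of `w`.
  decomposable ¬q with w 0 in eq
  ... | a = let κ , lim = decompose em (admissible ¬q eq) in inj₁ (mor a ∘ κ , member ∘ κ , lim a)
    where
    member : ∀ s → (｛ La ｝ ∪ ｛ Rb ｝) (mor a s)
    member left  = inj₁ refl
    member right = inj₂ refl
  ... | b = let κ , lim = decompose em (admissible ¬q eq) in inj₂ (mor b ∘ κ , member ∘ κ , lim a)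
    where
    member : ∀ s → (｛ Lb ｝ ∪ ｛ Ra ｝) (mor b s)
    member left  = inj₁ refl
    member right = inj₂ refl

  ¬quasi₁ : InfinitelyDecomposableOver (｛ La ｝ ∪ ｛ Rb ｝) w ⊎ InfinitelyDecomposableOver (｛ Lb ｝ ∪ ｛ Ra ｝) w →
    ¬ Quasiperiodic w
  ¬quasi₁ (inj₁ (_ , over , lim)) = decomposed⇒¬quasiperiodic {a} over em aper lim
  ¬quasi₁ (inj₂ (_ , over , lim)) = decomposed⇒¬quasiperiodic {b} over em aper lim

  alternates : ¬ Quasiperiodic w → ∃[ d ] (∀ k → 1 ≤ d (suc k)) ×
    (IsLimitOf w (alternating La Rb d) ⊎ IsLimitOf w (alternating Lb Ra d))
  alternates ¬q with w 0 in eq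
  ... | a = let d , d≥1 , lim = alternate em (admissible ¬q eq) in d , d≥1 , inj₁ (lim a)
  ... | b = let d , d≥1 , lim = alternate em (admissible ¬q eq) in d , d≥1 , inj₂ (lim a)

  ¬quasi₂ : ∃[ d ] (∀ k → 1 ≤ d (suc k)) ×
    (IsLimitOf w (alternating La Rb d) ⊎ IsLimitOf w (alternating Lb Ra d)) → ¬ Quasiperiodic w
  ¬quasi₂ (d , d≥1 , inj₁ lim) = alternating⇒¬quasiperiodic a d d≥1 lim
  ¬quasi₂ (d , d≥1 , inj₂ lim) = alternating⇒¬quasiperiodic b d d≥1 lim
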